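{- Let $q$ be an odd prime power, let $d$ be even, let $i \in \{1,2\}$ and $Q = Q_i^d$. Let $P \subseteq \mathbb{F}_q^d$. (a) If $S$ is a set of $Q$-spheres all of whose radii are non-zero, then \[\left| I(P,S) - q^{ -1}|P|\,|S|\right| \leq (1+o(1))\sqrt{|P|\left(q^{d-1}|S| + q^{d/2-1}|S|^2\right)}.\] (b) If $i = 2$ and $S$ is a set of $Q$-spheres all of radius zero, then \[\left| I(P,S) - q^{ -1}|P|\,|S|\right| \leq (1+o(1))\sqrt{|P|\left(q^{d-1}|S| + q^{d/2-1}|S|^2\right)}.\] (c) If $i = 1$ and $S$ is a set of $Q$-spheres all of radius zero, then \[\left| I(P,S) - q^{ -1}|P|\,|S|\right| \leq (1+o(1))\sqrt{|P|\left(q^{d-1}|S| + q^{d/2}|S|^2\right)}.\] Here $o(1)$ denotes a quantity depending only on $q$ and $d$ that tends to $0$ as $q \to \infty$ with $d$ fixed (uniformly in $P$ and $S$).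
   Context: $\mathbb{F}_q$ is the finite field with $q$ elements. Fix a non-square $\epsilon \in \mathbb{F}_q$. For even $d$, define quadratic forms on $\mathbb{F}_q^d$ by $Q_1^d(x) = x_1x_2 + x_3x_4 + \cdots + x_{d-1}x_d$ and $Q_2^d(x) = x_1x_2 + x_3x_4 + \cdots + x_{d-3}x_{d-2} + x_{d-1}^2 - \epsilon x_d^2$. For a quadratic form $Q$, the $Q$-sphere with center $y \in \mathbb{F}_q^d$ and radius $r \in \mathbb{F}_q$ is $\{x \in \mathbb{F}_q^d : Q(x-y) = r\}$; a sphere is specified by its center and radius. For $P \subseteq \mathbb{F}_q^d$ and a set $S$ of spheres, $I(P,S) = \#\{(x,s) \in P \times S : x \in s\}$. -}

module Defs where

open import Data.Nat as ℕ using (ℕ; zero; suc; _≤_; _^_)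
open import Data.Integer as ℤ using (ℤ; ∣_∣)
open import Data.Product using (_×_; _,_; ∃-syntax)
open import Data.List as List using (List; length; filter; map)
open import Data.Nat.ListAction using (sum)
open import Data.List.Membership.Propositional using (_∈_)
open import Data.List.Relation.Unary.Unique.Propositional using (Unique)
open import Data.Vec using (Vec; []; _∷_; zipWith)
open import Relation.Binary.PropositionalEquality using (_≡_; _≢_)
open import Relation.Nullary using (Dec)
open import Algebra.Structures using (IsCommutativeRing)

record FiniteField : Set₁ where
  infixl 6 _+_
  infixl 7 _*_
  field
    Carrier : Set
    _≟_ : (x y : Carrier) → Dec (x ≡ y)
    _+_ _*_ : Carrier → Carrier → Carrier
    -_ : Carrier → Carrier
    0# 1# : Carrier
    isCommutativeRing : IsCommutativeRing _≡_ _+_ _*_ -_ 0# 1#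
    0≢1 : 0# ≢ 1#
    inverse : ∀ x → x ≢ 0# → ∃[ y ] (x * y ≡ 1#)
    elements : List Carrier
    elements-complete : ∀ x → x ∈ elements
    elements-unique : Unique elements

  size : ℕ
  size = length elements

  NonSquare : Carrier → Set
  NonSquare e = ∀ y → y * y ≢ e

  _⊖_ : ∀ {d} → Vec Carrier d → Vec Carrier d → Vec Carrier d
  _⊖_ = zipWith (λ a b → a + (- b))

  -- Q₁^d(x) = x₁x₂ + x₃x₄ + ⋯ + x_{d-1}x_d  (used only for even d)
  Q₁ : ∀ {d} → Vec Carrier d → Carrier
  Q₁ [] = 0#
  Q₁ (a ∷ []) = 0#
  Q₁ (a ∷ b ∷ xs) = a * b + Q₁ xs

  -- Q₂^d(x) = x₁x₂ + ⋯ + x_{d-3}x_{d-2} + x_{d-1}² - ε x_d²  (used only for even d ≥ 2)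
  Q₂ : Carrier → ∀ {d} → Vec Carrier d → Carrier
  Q₂ ε (a ∷ b ∷ []) = a * a + (- (ε * (b * b)))
  Q₂ ε (a ∷ b ∷ c ∷ xs) = a * b + Q₂ ε (c ∷ xs)
  Q₂ ε _ = 0#

data Idx : Set where
  one two : Idx

module _ (F : FiniteField) where
  open FiniteField F

  Qform : Idx → Carrier → ∀ {d} → Vec Carrier d → Carrier
  Qform one ε = Q₁
  Qform two ε = Q₂ ε

  Sphere : ℕ → Set
  Sphere d = Vec Carrier d × Carrier

  onSphere? : ∀ {d} (Q : Vec Carrier d → Carrier) (x : Vec Carrier d) (s : Sphere d) → Dec (Q (x ⊖ (Data.Product.proj₁ s)) ≡ Data.Product.proj₂ s)
  onSphere? Q x (y , r) = Q (x ⊖ y) ≟ r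

  incidences : ∀ {d} (Q : Vec Carrier d → Carrier) → List (Vec Carrier d) → List (Sphere d) → ℕ
  incidences Q P S = sum (map (λ x → length (filter (onSphere? Q x) S)) P)

-- The squared-and-cleared form of
--   | I - q⁻¹|P||S| | ≤ (1 + 1/(k+1)) √(|P| (q^a |S| + q^b |S|²)),
-- namely (k+1)² (q I - |P||S|)² ≤ (k+2)² q² |P| (q^a |S| + q^b |S|²).
Bound : (k q I nP nS a b : ℕ) → Set
Bound k q I nP nS a b =
  (suc k ℕ.^ 2) ℕ.* (∣ ℤ.+ (q ℕ.* I) ℤ.- ℤ.+ (nP ℕ.* nS) ∣ ^ 2)
    ≤ (suc (suc k) ^ 2) ℕ.* (q ^ 2) ℕ.* nP ℕ.* ((q ^ a) ℕ.* nS ℕ.+ (q ^ b) ℕ.* (nS ^ 2))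

{-# OPTIONS --safe #-}
module Submission where

-- By Cauchy-Schwarz, (q I - |P||S|)² is at most |P| times the sum over s, t in S of the correlations
-- Σ_x (q [x ∈ s] - 1)(q [x ∈ t] - 1), so it suffices to bound these from above. With n = d / 2, a form
-- of type σ = ±1 takes the value a exactly q^(2n-1) + σ (q [a = 0] - 1) q^(n-1) times. Counting incidences
-- with the q members of the pencil of two spheres with distinct centres gives
-- q² |s ∩ t| = q^(2n) + σ (Z - 1) q^(n+1), where Z is the number of members of radius zero. The radius
-- is a polynomial of degree at most 2 in the pencil parameter, so Z ≤ 2 for non-zero radii, whereas
-- 2 ≤ Z ≤ q for radius zero; the sign of σ decides which side is needed.

open import Defs
open import Algebra.Bundles using (CommutativeRing)
open import Data.List using (List; []; _∷_; length; filter; map; cartesianProductWith; _++_)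
open import Data.List.Membership.Propositional using (_∈_; lose)
open import Data.List.Membership.Propositional.Properties using (∈-cartesianProductWith⁺)
open import Data.List.Relation.Unary.All as All using (All; []; _∷_)
open import Data.List.Relation.Unary.AllPairs using ([]; _∷_)
open import Data.List.Relation.Unary.Any as Any using (here; there)
open import Data.List.Relation.Unary.Unique.Propositional using (Unique)
open import Data.List.Relation.Unary.Unique.Propositional.Properties using (cartesianProductWith⁺)
open import Data.Nat.ListAction using (sum)
open import Data.Product using (_×_; _,_; ∃-syntax; proj₂)
open import Data.Product.Properties using () renaming (≡-dec to ×-≡-dec)
open import Data.Sum using (_⊎_; inj₁; inj₂)
open import Data.Vec as Vec using (Vec; []; _∷_; zipWith; replicate)
open import Data.Vec.Properties using (∷-injective; ≡-dec)
open import Function using (_∘_)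
open import Level using (0ℓ)
open import Relation.Binary using (DecidableEquality)
open import Relation.Binary.PropositionalEquality hiding (J)
open import Relation.Nullary using (Dec; yes; no; ¬_; contradiction)
open import Relation.Nullary.Decidable using (dec⇒maybe)
open import Relation.Unary using (Pred; Decidable)

-- Every pair of spheres enters the second moment with weight 1, so large negative correlations only
-- help; this is why one-sided information on Z suffices. For distinct centres the four main terms
-- q^(2n) of the correlation cancel, and what is left has order q^(n+1) as long as Z stays bounded.
-- Case (c) loses a factor q because centres with isotropic difference make the radius vanish along
-- the whole pencil, so that Z = q; in the elliptic case the same event makes the correlation very
-- negative. No character sums are needed: the pencil reduces intersections to sizes of single
-- spheres, and these follow by adding hyperbolic planes to the zero form in dimension 0 or to the
-- norm form a² - ε b² in dimension 2. Only the norm form needs a separate idea, namely that every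
-- non-zero value is represented, which comes from comparing totals. Counts are stated after
-- multiplication by q, so that all exponents are natural numbers. The coefficient reached is q (q +
-- 2) instead of q²; the ratio 1 + 2/q is at most (1 + 1/(k+1))² once q is at least k + 1, and this
-- is the whole o(1).

-- Finite sums of integers, indicators, and the Cauchy-Schwarz inequality.

module Sums where

  open import Data.Integer
  open import Data.Integer.Properties
  open import Data.Integer.Tactic.RingSolver using (solve-∀)
  import Data.Nat as ℕ

  private variable
    A B : Set

  ∑ : List A → (A → ℤ) → ℤ
  ∑ []      f = 0ℤ
  ∑ (x ∷ l) f = f x + ∑ l f

  infixr 6.5 ∑
  syntax ∑ l (λ x → e) = ∑[ x ← l ] e

  𝟙 : Dec A → ℤ
  𝟙 (yes _) = 1ℤ
  𝟙 (no _)  = 0ℤ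

  𝟙-true : A → (d : Dec A) → 𝟙 d ≡ 1ℤ
  𝟙-true a (yes _) = refl
  𝟙-true a (no ¬a) = contradiction a ¬a

  𝟙-false : ¬ A → (d : Dec A) → 𝟙 d ≡ 0ℤ
  𝟙-false ¬a (yes a) = contradiction a ¬a
  𝟙-false ¬a (no _)  = refl

  𝟙-⇔ : (A → B) → (B → A) → (a : Dec A) (b : Dec B) → 𝟙 a ≡ 𝟙 b
  𝟙-⇔ f g (yes a) b = sym (𝟙-true (f a) b)
  𝟙-⇔ f g (no ¬a) b = sym (𝟙-false (¬a ∘ g) b)

  𝟙-nonneg : (d : Dec A) → 0ℤ ≤ 𝟙 d
  𝟙-nonneg (yes _) = +≤+ ℕ.z≤n
  𝟙-nonneg (no _)  = ≤-refl

  𝟙-idem : (d : Dec A) → 𝟙 d * 𝟙 d ≡ 𝟙 d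
  𝟙-idem (yes _) = refl
  𝟙-idem (no _)  = refl

  𝟙≤1 : (d : Dec A) → 𝟙 d ≤ 1ℤ
  𝟙≤1 (yes _) = ≤-refl
  𝟙≤1 (no _)  = +≤+ ℕ.z≤n

  *-nonneg : ∀ {i j} → 0ℤ ≤ i → 0ℤ ≤ j → 0ℤ ≤ i * j
  *-nonneg {+ m} {+ n} _ _ = subst (0ℤ ≤_) (pos-* m n) (+≤+ ℕ.z≤n)

  square-nonneg : ∀ i → 0ℤ ≤ i * i
  square-nonneg (+ n)      = *-nonneg {+ n} {+ n} (+≤+ ℕ.z≤n) (+≤+ ℕ.z≤n)
  square-nonneg -[1+ n ] = +≤+ ℕ.z≤n

  ∑-cong : ∀ (l : List A) {f g : A → ℤ} → (∀ x → f x ≡ g x) → ∑ l f ≡ ∑ l g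
  ∑-cong []      f≗g = refl
  ∑-cong (x ∷ l) f≗g = cong₂ _+_ (f≗g x) (∑-cong l f≗g)

  ∑-zero : ∀ (l : List A) → ∑ l (λ _ → 0ℤ) ≡ 0ℤ
  ∑-zero []      = refl
  ∑-zero (x ∷ l) = trans (+-identityˡ _) (∑-zero l)

  ∑-const : ∀ (l : List A) c → ∑ l (λ _ → c) ≡ + length l * c
  ∑-const []      c = sym (*-zeroˡ c)
  ∑-const (x ∷ l) c = trans (cong (_+_ c) (∑-const l c)) (sym (suc-* (+ length l) c))

  ∑-+ : ∀ (l : List A) (f g : A → ℤ) → ∑ l (λ x → f x + g x) ≡ ∑ l f + ∑ l g
  ∑-+ []      f g = refl
  ∑-+ (x ∷ l) f g = trans (cong (_+_ (f x + g x)) (∑-+ l f g)) (lem (f x) (g x) (∑ l f) (∑ l g))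
    where
    lem : ∀ a b c d → a + b + (c + d) ≡ a + c + (b + d)
    lem = solve-∀

  ∑-*ˡ : ∀ (l : List A) c (f : A → ℤ) → ∑ l (λ x → c * f x) ≡ c * ∑ l f
  ∑-*ˡ []      c f = sym (*-zeroʳ c)
  ∑-*ˡ (x ∷ l) c f = trans (cong (_+_ (c * f x)) (∑-*ˡ l c f)) (sym (*-distribˡ-+ c (f x) (∑ l f)))

  ∑-swap : ∀ (l : List A) (m : List B) (f : A → B → ℤ) →
           ∑[ x ← l ] ∑[ y ← m ] f x y ≡ ∑[ y ← m ] ∑[ x ← l ] f x y
  ∑-swap []      m f = sym (∑-zero m)
  ∑-swap (x ∷ l) m f = trans (cong (_+_ (∑ m (f x))) (∑-swap l m f)) (sym (∑-+ m (f x) _))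

  ∑-product : ∀ (l : List A) (m : List B) (f : A → ℤ) (g : B → ℤ) →
              ∑ l f * ∑ m g ≡ ∑[ x ← l ] ∑[ y ← m ] f x * g y
  ∑-product l m f g = begin
    ∑ l f * ∑ m g                       ≡⟨ *-comm (∑ l f) (∑ m g) ⟩
    ∑ m g * ∑ l f                       ≡⟨ ∑-*ˡ l (∑ m g) f ⟨
    ∑[ x ← l ] ∑ m g * f x              ≡⟨ ∑-cong l (λ x → trans (*-comm (∑ m g) (f x)) (sym (∑-*ˡ m (f x) g))) ⟩
    ∑[ x ← l ] ∑[ y ← m ] f x * g y     ∎
    where open ≡-Reasoning

  ∑-mono : ∀ (l : List A) {f g : A → ℤ} → (∀ x → f x ≤ g x) → ∑ l f ≤ ∑ l g
  ∑-mono []      f≤g = ≤-refl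
  ∑-mono (x ∷ l) f≤g = +-mono-≤ (f≤g x) (∑-mono l f≤g)

  ∑-mono-All : ∀ {l : List A} {P : Pred A 0ℓ} {f g : A → ℤ} → All P l →
               (∀ {x} → P x → f x ≤ g x) → ∑ l f ≤ ∑ l g
  ∑-mono-All []        f≤g = ≤-refl
  ∑-mono-All (px ∷ ps) f≤g = +-mono-≤ (f≤g px) (∑-mono-All ps f≤g)

  ∑-nonneg : ∀ (l : List A) {f : A → ℤ} → (∀ x → 0ℤ ≤ f x) → 0ℤ ≤ ∑ l f
  ∑-nonneg l 0≤f = subst (_≤ ∑ l _) (∑-zero l) (∑-mono l 0≤f)

  ∑-++ : ∀ (l m : List A) f → ∑ (l ++ m) f ≡ ∑ l f + ∑ m f
  ∑-++ []      m f = sym (+-identityˡ _)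
  ∑-++ (x ∷ l) m f = trans (cong (_+_ (f x)) (∑-++ l m f)) (sym (+-assoc (f x) _ _))

  ∑-map : ∀ (h : A → B) l f → ∑ (map h l) f ≡ ∑ l (f ∘ h)
  ∑-map h []      f = refl
  ∑-map h (x ∷ l) f = cong (_+_ (f (h x))) (∑-map h l f)

  ∑-cartesianProductWith : ∀ {C : Set} (h : A → B → C) l m f →
    ∑ (cartesianProductWith h l m) f ≡ ∑[ x ← l ] ∑[ y ← m ] f (h x y)
  ∑-cartesianProductWith h []      m f = refl
  ∑-cartesianProductWith h (x ∷ l) m f =
    trans (∑-++ (map (h x) m) _ f) (cong₂ _+_ (∑-map (h x) m f) (∑-cartesianProductWith h l m f))

  -- Used to sharpen one-sided estimates: bounds that hold for each term become equalities once
  -- their totals agree.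
  ∑-nonneg-zero : ∀ (l : List A) {f : A → ℤ} → (∀ x → 0ℤ ≤ f x) → ∑ l f ≡ 0ℤ →
                  ∀ {x} → x ∈ l → f x ≡ 0ℤ
  ∑-nonneg-zero (y ∷ l) {f} 0≤f eq x∈l = go x∈l
    where
    f[y]≤0 : f y ≤ 0ℤ
    f[y]≤0 = subst₂ _≤_ (+-identityʳ (f y)) eq (+-monoʳ-≤ (f y) (∑-nonneg l 0≤f))

    f[y]≡0 : f y ≡ 0ℤ
    f[y]≡0 = ≤-antisym f[y]≤0 (0≤f y)

    go : ∀ {x} → x ∈ y ∷ l → f x ≡ 0ℤ
    go (here refl)  = f[y]≡0
    go (there x∈l′) =
      ∑-nonneg-zero l 0≤f (trans (sym (+-identityˡ _)) (trans (cong (_+ ∑ l f) (sym f[y]≡0)) eq)) x∈l′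

  -- Lagrange's identity: the squares of `f x - f y`, summed over all pairs, add up to twice the
  -- difference of the two sides.
  cauchy-schwarz : ∀ (l : List A) f → ∑ l f * ∑ l f ≤ + length l * (∑[ x ← l ] f x * f x)
  cauchy-schwarz l f = *-cancelˡ-≤-pos _ _ (+ 2) (i-j≤0⇒i≤j (subst (_≤ 0ℤ) expand (neg-mono-≤ nonneg)))
    where
    S S² n : ℤ
    S = ∑ l f
    S² = ∑[ x ← l ] f x * f x
    n = + length l

    nonneg : 0ℤ ≤ ∑[ x ← l ] ∑[ y ← l ] (f x - f y) * (f x - f y)
    nonneg = ∑-nonneg l λ x → ∑-nonneg l λ y → square-nonneg (f x - f y)

    binomial : ∀ a b → (a - b) * (a - b) ≡ a * a + (- (+ 2) * a * b + b * b)
    binomial = solve-∀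

    inner : ∀ x → ∑[ y ← l ] (f x - f y) * (f x - f y) ≡ n * (f x * f x) + (- (+ 2) * S * f x + S²)
    inner x = begin
      ∑[ y ← l ] (f x - f y) * (f x - f y)
        ≡⟨ ∑-cong l (λ y → binomial (f x) (f y)) ⟩
      ∑[ y ← l ] (f x * f x + (- (+ 2) * f x * f y + f y * f y))
        ≡⟨ ∑-+ l _ _ ⟩
      ∑[ y ← l ] f x * f x + ∑[ y ← l ] (- (+ 2) * f x * f y + f y * f y)
        ≡⟨ cong₂ _+_ (∑-const l _) (trans (∑-+ l _ _) (cong (_+ S²) (∑-*ˡ l (- (+ 2) * f x) f))) ⟩
      n * (f x * f x) + (- (+ 2) * f x * S + S²)
        ≡⟨ rearrange (f x) S S² n ⟩
      n * (f x * f x) + (- (+ 2) * S * f x + S²) ∎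
      where
      open ≡-Reasoning
      rearrange : ∀ a s t k → k * (a * a) + (- (+ 2) * a * s + t) ≡ k * (a * a) + (- (+ 2) * s * a + t)
      rearrange = solve-∀

    expand : - (∑[ x ← l ] ∑[ y ← l ] (f x - f y) * (f x - f y)) ≡ + 2 * (S * S) - + 2 * (n * S²)
    expand = begin
      - (∑[ x ← l ] ∑[ y ← l ] (f x - f y) * (f x - f y))
        ≡⟨ cong -_ (trans (∑-cong l inner) (trans (∑-+ l _ _) (cong (_+_ (∑ l _)) (∑-+ l _ _)))) ⟩
      - (∑[ x ← l ] n * (f x * f x) + (∑[ x ← l ] - (+ 2) * S * f x + ∑[ x ← l ] S²))
        ≡⟨ cong -_ (cong₂ _+_ (∑-*ˡ l n _) (cong₂ _+_ (∑-*ˡ l (- (+ 2) * S) f) (∑-const l S²))) ⟩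
      - (n * S² + (- (+ 2) * S * S + n * S²))
        ≡⟨ rearrange n S S² ⟩
      + 2 * (S * S) - + 2 * (n * S²) ∎
      where
      open ≡-Reasoning
      rearrange : ∀ k s t → - (k * t + (- (+ 2) * s * s + k * t)) ≡ + 2 * (s * s) - + 2 * (k * t)
      rearrange = solve-∀

  +length-filter : ∀ {P : Pred A 0ℓ} (P? : Decidable P) l → + length (filter P? l) ≡ ∑[ x ← l ] 𝟙 (P? x)
  +length-filter P? [] = refl
  +length-filter P? (x ∷ l) with P? x
  ... | yes _ = cong (_+_ 1ℤ) (+length-filter P? l)
  ... | no _  = trans (+length-filter P? l) (sym (+-identityˡ _))

  +sum-map : ∀ (f : A → ℕ.ℕ) l → + sum (map f l) ≡ ∑[ x ← l ] + f x
  +sum-map f []      = refl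
  +sum-map f (x ∷ l) = trans (pos-+ (f x) _) (cong (_+_ (+ f x)) (+sum-map f l))

  -- The pairs above and below the diagonal have equal sums and the diagonal vanishes; `k` is the
  -- sum above the diagonal. This is the parity count behind `1+1≢0`.
  ∑-symmetric-even : ∀ (l : List A) (h : A → A → ℤ) → (∀ x → h x x ≡ 0ℤ) → (∀ x y → h x y ≡ h y x) →
    ∃[ k ] ∑[ x ← l ] ∑[ y ← l ] h x y ≡ + 2 * k
  ∑-symmetric-even [] h irrefl symm = 0ℤ , refl
  ∑-symmetric-even (x ∷ l) h irrefl symm with ∑-symmetric-even l h irrefl symm
  ... | k , eq = r + k , (begin
    h x x + r + (∑[ z ← l ] (h z x + (∑[ y ← l ] h z y)))
      ≡⟨ cong₂ (λ i s → i + r + s) (irrefl x) (∑-+ l _ _) ⟩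
    0ℤ + r + (∑[ z ← l ] h z x + ∑[ z ← l ] ∑[ y ← l ] h z y)
      ≡⟨ cong₂ (λ s t → 0ℤ + r + (s + t)) (∑-cong l λ z → symm z x) eq ⟩
    0ℤ + r + (r + + 2 * k)
      ≡⟨ rearrange r k ⟩
    + 2 * (r + k) ∎)
    where
    open ≡-Reasoning
    r : ℤ
    r = ∑[ y ← l ] h x y
    rearrange : ∀ r k → 0ℤ + r + (r + + 2 * k) ≡ + 2 * (r + k)
    rearrange = solve-∀

  module _ (_≟_ : DecidableEquality A) where

    count-∉ : ∀ {x l} → All (x ≢_) l → ∑[ y ← l ] 𝟙 (y ≟ x) ≡ 0ℤ
    count-∉ []         = refl
    count-∉ (x≢y ∷ ps) = cong₂ _+_ (𝟙-false (x≢y ∘ sym) (_ ≟ _)) (count-∉ ps)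

    count-∈ : ∀ {x l} → Unique l → x ∈ l → ∑[ y ← l ] 𝟙 (y ≟ x) ≡ 1ℤ
    count-∈ (y∉ ∷ _) (here refl) = cong₂ _+_ (𝟙-true refl (_ ≟ _)) (count-∉ y∉)
    count-∈ (y∉ ∷ u) (there x∈)  =
      cong₂ _+_ (𝟙-false (All.lookup y∉ x∈) (_ ≟ _)) (count-∈ u x∈)

    count-≤1 : ∀ x {l} → Unique l → ∑[ y ← l ] 𝟙 (y ≟ x) ≤ 1ℤ
    count-≤1 x []                   = +≤+ ℕ.z≤n
    count-≤1 x {y ∷ l} (y∉ ∷ u) with y ≟ x
    ... | yes refl = ≤-reflexive (cong (_+_ 1ℤ) (count-∉ y∉))
    ... | no _     = subst (_≤ 1ℤ) (sym (+-identityˡ _)) (count-≤1 x u)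

    𝟙-subst : ∀ (f : A → ℤ) x y → 𝟙 (y ≟ x) * f y ≡ f x * 𝟙 (y ≟ x)
    𝟙-subst f x y with y ≟ x
    ... | yes refl = *-comm 1ℤ (f y)
    ... | no _     = trans (*-zeroˡ (f y)) (sym (*-zeroʳ (f x)))

    ∑-δ : ∀ {l} → Unique l → ∀ {x} → x ∈ l → ∀ f → ∑[ y ← l ] 𝟙 (y ≟ x) * f y ≡ f x
    ∑-δ {l} u {x} x∈ f = begin
      ∑[ y ← l ] 𝟙 (y ≟ x) * f y ≡⟨ ∑-cong l (𝟙-subst f x) ⟩
      ∑[ y ← l ] f x * 𝟙 (y ≟ x) ≡⟨ ∑-*ˡ l (f x) _ ⟩
      f x * (∑[ y ← l ] 𝟙 (y ≟ x)) ≡⟨ cong (f x *_) (count-∈ u x∈) ⟩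
      f x * 1ℤ                   ≡⟨ *-identityʳ (f x) ⟩
      f x                        ∎
      where open ≡-Reasoning

    module _ {l : List A} (unique : Unique l) (complete : ∀ x → x ∈ l) where

      -- Writing `f (π x)` as a sum over `y` against the indicator of `y ≡ π x` and exchanging the
      -- sums turns the indicator into that of `x ≡ π⁻¹ y`. Thus no permutation of the list has to
      -- be constructed.
      ∑-reindex : ∀ (π π⁻¹ : A → A) → (∀ x → π (π⁻¹ x) ≡ x) → (∀ x → π⁻¹ (π x) ≡ x) →
                  ∀ f → ∑ l (f ∘ π) ≡ ∑ l f
      ∑-reindex π π⁻¹ invʳ invˡ f = begin
        ∑[ x ← l ] f (π x)                               ≡⟨ ∑-cong l (λ x → ∑-δ unique (complete (π x)) f) ⟨
        ∑[ x ← l ] ∑[ y ← l ] 𝟙 (y ≟ π x) * f y         ≡⟨ ∑-swap l l _ ⟩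
        ∑[ y ← l ] ∑[ x ← l ] 𝟙 (y ≟ π x) * f y         ≡⟨ ∑-cong l (λ y → ∑-cong l λ x → cong (_* f y)
                                                              (𝟙-⇔ (to x y) (from x y) (y ≟ π x) (x ≟ π⁻¹ y))) ⟩
        ∑[ y ← l ] ∑[ x ← l ] 𝟙 (x ≟ π⁻¹ y) * f y       ≡⟨ ∑-cong l (λ y → ∑-δ unique (complete (π⁻¹ y)) (λ _ → f y)) ⟩
        ∑[ y ← l ] f y                                   ∎
        where
        open ≡-Reasoning
        to : ∀ x y → y ≡ π x → x ≡ π⁻¹ y
        to x y refl = sym (invˡ x)
        from : ∀ x y → x ≡ π⁻¹ y → y ≡ π x
        from x y refl = sym (invʳ y)

      -- After the exchange of sums each `y` carries its multiplicity in `P`, which is at most 1;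
      -- positivity of `f` then discards it.
      ∑-⊆ : ∀ {P} → Unique P → ∀ {f} → (∀ x → 0ℤ ≤ f x) → ∑ P f ≤ ∑ l f
      ∑-⊆ {P} uP {f} 0≤f = begin
        ∑[ x ← P ] f x                              ≡⟨ ∑-cong P (λ x → ∑-δ unique (complete x) f) ⟨
        ∑[ x ← P ] ∑[ y ← l ] 𝟙 (y ≟ x) * f y      ≡⟨ ∑-swap P l _ ⟩
        ∑[ y ← l ] ∑[ x ← P ] 𝟙 (y ≟ x) * f y      ≡⟨ ∑-cong l (λ y → trans (∑-cong P λ x → trans (*-comm _ (f y))
                                                        (cong (f y *_) (𝟙-⇔ sym sym (y ≟ x) (x ≟ y)))) (∑-*ˡ P (f y) _)) ⟩
        ∑[ y ← l ] f y * (∑[ x ← P ] 𝟙 (x ≟ y))      ≤⟨ ∑-mono l (λ y → *-monoˡ-≤-nonNeg (f y) ⦃ nonNegative (0≤f y) ⦄ (count-≤1 y uP)) ⟩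
        ∑[ y ← l ] f y * 1ℤ                        ≡⟨ ∑-cong l (λ y → *-identityʳ (f y)) ⟩
        ∑[ y ← l ] f y                              ∎
        where open ≤-Reasoning

-- A ring solver for the field, with integer coefficients.

module FieldSolver (F : FiniteField) where

  open FiniteField F hiding (_⊖_)
  open import Data.Integer using (ℤ; +_; -[1+_]; _⊖_)
  import Data.Integer as ℤ
  import Data.Integer.Properties as ℤ
  import Data.Nat as ℕ
  import Data.Nat.Properties as ℕ
  open import Data.Maybe using () renaming (map to mapMaybe)
  open import Algebra.Solver.Ring.AlmostCommutativeRing

  commutativeRing : CommutativeRing 0ℓ 0ℓ
  commutativeRing = record { isCommutativeRing = isCommutativeRing }

  open CommutativeRing commutativeRing public
    using (+-identityˡ; +-identityʳ; +-comm; *-comm; *-assoc; *-identityˡ; zeroˡ; zeroʳ; -‿inverseʳ; -‿inverseˡ)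
  open CommutativeRing commutativeRing using (ring; semiring; +-abelianGroup)
  open import Algebra.Properties.Ring ring using (-‿distribˡ-*; -‿distribʳ-*; -0#≈0#; -‿involutive)
  open import Algebra.Properties.AbelianGroup +-abelianGroup using (⁻¹-∙-comm)
  open import Algebra.Properties.Semiring.Mult.TCOptimised semiring using (1+×; ×-homo-+; ×1-homo-*)
    renaming (_×_ to _·_)
  open ≡-Reasoning

  -- The canonical homomorphism from the integers. Integer coefficients can be compared by
  -- computation, which elements of an abstract field do not allow. The optimised multiple makes
  -- `1 · 1#` equal to `1#` by definition, so `con 1ℤ` denotes `1#` itself.
  ⟦_⟧ : ℤ → Carrier
  ⟦ + n ⟧      = n · 1#
  ⟦ -[1+ n ] ⟧ = - (ℕ.suc n · 1#)

  -‿homo : ∀ i → ⟦ ℤ.- i ⟧ ≡ - ⟦ i ⟧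
  -‿homo (+ 0)       = sym -0#≈0#
  -‿homo (+ ℕ.suc n) = refl
  -‿homo -[1+ n ]    = sym (-‿involutive _)

  ⊖-homo : ∀ m n → ⟦ m ⊖ n ⟧ ≡ m · 1# + - (n · 1#)
  ⊖-homo m         0         = sym (trans (cong (_+_ (m · 1#)) -0#≈0#) (+-identityʳ _))
  ⊖-homo 0         (ℕ.suc n) = sym (+-identityˡ _)
  ⊖-homo (ℕ.suc m) (ℕ.suc n) = begin
    ⟦ ℕ.suc m ⊖ ℕ.suc n ⟧              ≡⟨ cong ⟦_⟧ (ℤ.[1+m]⊖[1+n]≡m⊖n m n) ⟩
    ⟦ m ⊖ n ⟧                          ≡⟨ ⊖-homo m n ⟩
    a + - b                            ≡⟨ +-identityˡ _ ⟨
    0# + (a + - b)                     ≡⟨ cong (_+ (a + - b)) (-‿inverseʳ 1#) ⟨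
    (1# + - 1#) + (a + - b)            ≡⟨ interchange 1# (- 1#) a (- b) ⟩
    (1# + a) + (- 1# + - b)            ≡⟨ cong (_+_ (1# + a)) (⁻¹-∙-comm 1# b) ⟩
    (1# + a) + - (1# + b)              ≡⟨ cong₂ (λ x y → x + - y) (1+× m 1#) (1+× n 1#) ⟨
    ℕ.suc m · 1# + - (ℕ.suc n · 1#)    ∎
    where
    a b : Carrier
    a = m · 1#
    b = n · 1#
    open import Algebra.Properties.CommutativeSemigroup
      (CommutativeRing.+-commutativeSemigroup commutativeRing) using (interchange)

  +-homo : ∀ i j → ⟦ i ℤ.+ j ⟧ ≡ ⟦ i ⟧ + ⟦ j ⟧
  +-homo (+ m)    (+ n)    = ×-homo-+ 1# m n
  +-homo (+ m)    -[1+ n ] = ⊖-homo m (ℕ.suc n)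
  +-homo -[1+ m ] (+ n)    = trans (⊖-homo n (ℕ.suc m)) (+-comm _ _)
  +-homo -[1+ m ] -[1+ n ] = begin
    - (ℕ.suc (ℕ.suc (m ℕ.+ n)) · 1#)            ≡⟨ cong (λ k → - (ℕ.suc k · 1#)) (ℕ.+-suc m n) ⟨
    - ((ℕ.suc m ℕ.+ ℕ.suc n) · 1#)              ≡⟨ cong -_ (×-homo-+ 1# (ℕ.suc m) (ℕ.suc n)) ⟩
    - (ℕ.suc m · 1# + ℕ.suc n · 1#)             ≡⟨ ⁻¹-∙-comm _ _ ⟨
    - (ℕ.suc m · 1#) + - (ℕ.suc n · 1#)         ∎

  *-homo⁺ : ∀ m j → ⟦ + m ℤ.* j ⟧ ≡ ⟦ + m ⟧ * ⟦ j ⟧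
  *-homo⁺ m (+ n)    = trans (cong ⟦_⟧ (sym (ℤ.pos-* m n))) (×1-homo-* m n)
  *-homo⁺ m -[1+ n ] = begin
    ⟦ + m ℤ.* -[1+ n ] ⟧           ≡⟨ cong ⟦_⟧ (ℤ.neg-distribʳ-* (+ m) (+ ℕ.suc n)) ⟨
    ⟦ ℤ.- (+ m ℤ.* + ℕ.suc n) ⟧    ≡⟨ -‿homo (+ m ℤ.* + ℕ.suc n) ⟩
    - ⟦ + m ℤ.* + ℕ.suc n ⟧        ≡⟨ cong -_ (*-homo⁺ m (+ ℕ.suc n)) ⟩
    - (⟦ + m ⟧ * ⟦ + ℕ.suc n ⟧)    ≡⟨ -‿distribʳ-* _ _ ⟩
    ⟦ + m ⟧ * ⟦ -[1+ n ] ⟧         ∎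

  *-homo : ∀ i j → ⟦ i ℤ.* j ⟧ ≡ ⟦ i ⟧ * ⟦ j ⟧
  *-homo (+ m)    j = *-homo⁺ m j
  *-homo -[1+ m ] j = begin
    ⟦ -[1+ m ] ℤ.* j ⟧             ≡⟨ cong ⟦_⟧ (ℤ.neg-distribˡ-* (+ ℕ.suc m) j) ⟨
    ⟦ ℤ.- (+ ℕ.suc m ℤ.* j) ⟧      ≡⟨ -‿homo (+ ℕ.suc m ℤ.* j) ⟩
    - ⟦ + ℕ.suc m ℤ.* j ⟧          ≡⟨ cong -_ (*-homo⁺ (ℕ.suc m) j) ⟩
    - (⟦ + ℕ.suc m ⟧ * ⟦ j ⟧)      ≡⟨ -‿distribˡ-* _ _ ⟩
    ⟦ -[1+ m ] ⟧ * ⟦ j ⟧           ∎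

  morphism : ℤ.+-*-rawRing -Raw-AlmostCommutative⟶ fromCommutativeRing commutativeRing
  morphism = record
    { ⟦_⟧ = ⟦_⟧ ; +-homo = +-homo ; *-homo = *-homo ; -‿homo = -‿homo ; 0-homo = refl ; 1-homo = refl }

  open import Algebra.Solver.Ring ℤ.+-*-rawRing (fromCommutativeRing commutativeRing) morphism
    (λ i j → mapMaybe (cong ⟦_⟧) (dec⇒maybe (i ℤ.≟ j))) public
    using (solve; _:=_; _:+_; _:*_; :-_; con)

-- Counting solutions of linear and quadratic equations in one variable.

module FieldCounting (F : FiniteField) where

  open FiniteField F renaming (_+_ to _+ᶠ_; _*_ to _*ᶠ_; -_ to -ᶠ_; _≟_ to infix 4 _≟ᶠ_)
  open FieldSolver F
    using (solve; _:=_; _:+_; _:*_; :-_; con; -‿inverseʳ; -‿inverseˡ)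
    renaming ( +-identityˡ to +ᶠ-identityˡ; +-identityʳ to +ᶠ-identityʳ; +-comm to +ᶠ-comm
             ; *-comm to *ᶠ-comm; *-identityˡ to *ᶠ-identityˡ; *-assoc to *ᶠ-assoc; zeroʳ to zeroʳᶠ )
  open Sums
  open import Data.Integer hiding (_⊖_; _≟_)
  open import Data.Integer.Properties hiding (_≟_)
  open import Data.Integer.Tactic.RingSolver using (solve-∀)
  import Data.Nat as ℕ
  import Data.Nat.Properties as ℕ
  import Data.Nat.DivMod as ℕ
  open ≡-Reasoning

  q : ℤ
  q = + size

  δ : Carrier → ℤ
  δ x = 𝟙 (x ≟ᶠ 0#)

  infixl 6 _-ᶠ_
  _-ᶠ_ : Carrier → Carrier → Carrier
  x -ᶠ y = x +ᶠ -ᶠ y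

  x-y≡0⇒x≡y : ∀ {x y} → x -ᶠ y ≡ 0# → x ≡ y
  x-y≡0⇒x≡y {x} {y} eq = begin
    x              ≡⟨ solve 2 (λ x y → x := (x :+ :- y) :+ y) refl x y ⟩
    (x -ᶠ y) +ᶠ y  ≡⟨ cong (_+ᶠ y) eq ⟩
    0# +ᶠ y        ≡⟨ +ᶠ-identityˡ y ⟩
    y              ∎

  x≡y⇒x-y≡0 : ∀ {x y} → x ≡ y → x -ᶠ y ≡ 0#
  x≡y⇒x-y≡0 {x} refl = -‿inverseʳ x

  a*b≡0⇒b≡0 : ∀ {a b} → a ≢ 0# → a *ᶠ b ≡ 0# → b ≡ 0#
  a*b≡0⇒b≡0 {a} {b} a≢0 ab≡0 with inverse a a≢0
  ... | a⁻¹ , a*a⁻¹≡1 = begin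
    b                   ≡⟨ *ᶠ-identityˡ b ⟨
    1# *ᶠ b             ≡⟨ cong (_*ᶠ b) a*a⁻¹≡1 ⟨
    (a *ᶠ a⁻¹) *ᶠ b     ≡⟨ solve 3 (λ a i b → a :* i :* b := i :* (a :* b)) refl a a⁻¹ b ⟩
    a⁻¹ *ᶠ (a *ᶠ b)     ≡⟨ cong (a⁻¹ *ᶠ_) ab≡0 ⟩
    a⁻¹ *ᶠ 0#           ≡⟨ zeroʳᶠ a⁻¹ ⟩
    0#                  ∎

  a²≡0⇒a≡0 : ∀ {a} → a *ᶠ a ≡ 0# → a ≡ 0#
  a²≡0⇒a≡0 {a} eq with a ≟ᶠ 0#
  ... | yes a≡0 = a≡0
  ... | no a≢0  = a*b≡0⇒b≡0 a≢0 eq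

  𝟙-≟ : ∀ x y → 𝟙 (x ≟ᶠ y) ≡ δ (x -ᶠ y)
  𝟙-≟ x y = 𝟙-⇔ x≡y⇒x-y≡0 x-y≡0⇒x≡y (x ≟ᶠ y) (x -ᶠ y ≟ᶠ 0#)

  δ-zero : ∀ {x} → x ≡ 0# → δ x ≡ 1ℤ
  δ-zero x≡0 = 𝟙-true x≡0 (_ ≟ᶠ 0#)

  δ-nonzero : ∀ {x} → x ≢ 0# → δ x ≡ 0ℤ
  δ-nonzero x≢0 = 𝟙-false x≢0 (_ ≟ᶠ 0#)

  δ-* : ∀ {c} → c ≢ 0# → ∀ x → δ (c *ᶠ x) ≡ δ x
  δ-* {c} c≢0 x = 𝟙-⇔ (a*b≡0⇒b≡0 c≢0) (λ { refl → zeroʳᶠ c }) (c *ᶠ x ≟ᶠ 0#) (x ≟ᶠ 0#)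

  δ-neg : ∀ x → δ (-ᶠ x) ≡ δ x
  δ-neg x = 𝟙-⇔ (λ eq → trans (neg-neg x) (trans (cong -ᶠ_ eq) neg0)) (λ { refl → neg0 }) (-ᶠ x ≟ᶠ 0#) (x ≟ᶠ 0#)
    where
    neg-neg : ∀ x → x ≡ -ᶠ (-ᶠ x)
    neg-neg = solve 1 (λ x → x := :- (:- x)) refl
    neg0 : -ᶠ 0# ≡ 0#
    neg0 = solve 0 (:- con 0ℤ := con 0ℤ) refl

  ∑δ : ∑[ x ← elements ] δ x ≡ 1ℤ
  ∑δ = count-∈ _≟ᶠ_ elements-unique (elements-complete 0#)

  ∑-affine : ∀ {a} → a ≢ 0# → ∀ b f → ∑[ x ← elements ] f (a *ᶠ x +ᶠ b) ≡ ∑[ x ← elements ] f x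
  ∑-affine {a} a≢0 b f with inverse a a≢0
  ... | a⁻¹ , a*a⁻¹≡1 = ∑-reindex _≟ᶠ_ elements-unique elements-complete
      (λ x → a *ᶠ x +ᶠ b) (λ y → a⁻¹ *ᶠ (y -ᶠ b)) invʳ invˡ f
    where
    invʳ : ∀ y → a *ᶠ (a⁻¹ *ᶠ (y -ᶠ b)) +ᶠ b ≡ y
    invʳ y = begin
      a *ᶠ (a⁻¹ *ᶠ (y -ᶠ b)) +ᶠ b   ≡⟨ cong (_+ᶠ b) (*ᶠ-assoc a a⁻¹ _) ⟨
      (a *ᶠ a⁻¹) *ᶠ (y -ᶠ b) +ᶠ b   ≡⟨ cong (λ i → i *ᶠ (y -ᶠ b) +ᶠ b) a*a⁻¹≡1 ⟩
      1# *ᶠ (y -ᶠ b) +ᶠ b           ≡⟨ solve 2 (λ y b → con 1ℤ :* (y :+ :- b) :+ b := y) refl y b ⟩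
      y                             ∎
    invˡ : ∀ x → a⁻¹ *ᶠ ((a *ᶠ x +ᶠ b) -ᶠ b) ≡ x
    invˡ x = begin
      a⁻¹ *ᶠ ((a *ᶠ x +ᶠ b) -ᶠ b)   ≡⟨ solve 4 (λ a i x b → i :* ((a :* x :+ b) :+ :- b) := a :* i :* x) refl a a⁻¹ x b ⟩
      (a *ᶠ a⁻¹) *ᶠ x               ≡⟨ cong (_*ᶠ x) a*a⁻¹≡1 ⟩
      1# *ᶠ x                       ≡⟨ *ᶠ-identityˡ x ⟩
      x                             ∎

  ∑δ-affine : ∀ {a} → a ≢ 0# → ∀ b → ∑[ x ← elements ] δ (a *ᶠ x +ᶠ b) ≡ 1ℤ
  ∑δ-affine a≢0 b = trans (∑-affine a≢0 b δ) ∑δ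

  -- The affine function of `l` with value `X` at 0 and `Y` at 1 is constant or bijective. It has q
  -- zeros if both values vanish, none if they are equal and non-zero, and one if they differ.
  ∑δ-pencil : ∀ X Y → ∑[ l ← elements ] δ (X +ᶠ l *ᶠ (Y -ᶠ X)) ≡ 1ℤ - δ (X -ᶠ Y) + q * (δ X * δ Y)
  ∑δ-pencil X Y with X ≟ᶠ Y
  ... | yes refl = begin
    ∑[ l ← elements ] δ (X +ᶠ l *ᶠ (X -ᶠ X))
      ≡⟨ ∑-cong elements (λ l → cong δ (solve 2 (λ X l → X :+ l :* (X :+ :- X) := X) refl X l)) ⟩
    ∑[ l ← elements ] δ X
      ≡⟨ ∑-const elements (δ X) ⟩
    q * δ X
      ≡⟨ cong (q *_) (𝟙-idem (X ≟ᶠ 0#)) ⟨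
    q * (δ X * δ X)
      ≡⟨ +-identityˡ _ ⟨
    1ℤ - 1ℤ + q * (δ X * δ X)
      ≡⟨ cong (λ i → 1ℤ - i + q * (δ X * δ X)) (δ-zero (-‿inverseʳ X)) ⟨
    1ℤ - δ (X -ᶠ X) + q * (δ X * δ X) ∎
  ... | no X≢Y = begin
    ∑[ l ← elements ] δ (X +ᶠ l *ᶠ (Y -ᶠ X))
      ≡⟨ ∑-cong elements (λ l → cong δ (trans (+ᶠ-comm X _) (cong (_+ᶠ X) (*ᶠ-comm l _)))) ⟩
    ∑[ l ← elements ] δ ((Y -ᶠ X) *ᶠ l +ᶠ X)
      ≡⟨ ∑δ-affine (X≢Y ∘ sym ∘ x-y≡0⇒x≡y) X ⟩
    1ℤ
      ≡⟨ cong (_+_ 1ℤ) (*-zeroʳ q) ⟨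
    1ℤ - 0ℤ + q * 0ℤ
      ≡⟨ cong₂ (λ i j → 1ℤ - i + q * j) (δ-nonzero (X≢Y ∘ x-y≡0⇒x≡y)) (disjoint (X ≟ᶠ 0#) (Y ≟ᶠ 0#)) ⟨
    1ℤ - δ (X -ᶠ Y) + q * (δ X * δ Y) ∎
    where
    disjoint : (d : Dec (X ≡ 0#)) (e : Dec (Y ≡ 0#)) → 𝟙 d * 𝟙 e ≡ 0ℤ
    disjoint (yes X≡0) (yes Y≡0) = contradiction (trans X≡0 (sym Y≡0)) X≢Y
    disjoint (yes _)   (no _)    = refl
    disjoint (no _)    e         = *-zeroˡ (𝟙 e)

  -- If 1 + 1 were 0, then adding 1 would be an involution without fixed points, and the field would
  -- split into pairs.
  1+1≢0 : size ℕ.% 2 ≡ 1 → 1# +ᶠ 1# ≢ 0#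
  1+1≢0 odd 2≡0 with ∑-symmetric-even elements (λ x y → 𝟙 (y ≟ᶠ x +ᶠ 1#)) irrefl symm
    where
    irrefl : ∀ x → 𝟙 (x ≟ᶠ x +ᶠ 1#) ≡ 0ℤ
    irrefl x = 𝟙-false (λ x≡x+1 → 0≢1 (begin
      0#                   ≡⟨ -‿inverseˡ x ⟨
      -ᶠ x +ᶠ x            ≡⟨ cong (-ᶠ x +ᶠ_) x≡x+1 ⟩
      -ᶠ x +ᶠ (x +ᶠ 1#)    ≡⟨ solve 1 (λ x → :- x :+ (x :+ con 1ℤ) := con 1ℤ) refl x ⟩
      1#                   ∎)) _
    swap : ∀ x y → y ≡ x +ᶠ 1# → x ≡ y +ᶠ 1#
    swap x y refl = begin
      x                    ≡⟨ +ᶠ-identityʳ x ⟨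
      x +ᶠ 0#              ≡⟨ cong (x +ᶠ_) 2≡0 ⟨
      x +ᶠ (1# +ᶠ 1#)      ≡⟨ solve 1 (λ x → x :+ (con 1ℤ :+ con 1ℤ) := x :+ con 1ℤ :+ con 1ℤ) refl x ⟩
      x +ᶠ 1# +ᶠ 1#        ∎
    symm : ∀ x y → 𝟙 (y ≟ᶠ x +ᶠ 1#) ≡ 𝟙 (x ≟ᶠ y +ᶠ 1#)
    symm x y = 𝟙-⇔ (swap x y) (swap y x) _ _
  ... | k , eq = contradiction (trans (sym odd) even) λ ()
    where
    q≡2k : q ≡ + 2 * k
    q≡2k = begin
      q                                                        ≡⟨ *-identityʳ q ⟨
      q * 1ℤ                                                   ≡⟨ ∑-const elements 1ℤ ⟨
      ∑[ x ← elements ] 1ℤ                                     ≡⟨ ∑-cong elements (λ x → count-∈ _≟ᶠ_ elements-unique (elements-complete (x +ᶠ 1#))) ⟨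
      ∑[ x ← elements ] ∑[ y ← elements ] 𝟙 (y ≟ᶠ x +ᶠ 1#)      ≡⟨ eq ⟩
      + 2 * k                                                  ∎
    even : size ℕ.% 2 ≡ 0
    even = begin
      size ℕ.% 2               ≡⟨ cong (λ i → ∣ i ∣ ℕ.% 2) q≡2k ⟩
      ∣ + 2 * k ∣ ℕ.% 2        ≡⟨ cong (ℕ._% 2) (trans (abs-* (+ 2) k) (ℕ.*-comm 2 ∣ k ∣)) ⟩
      (∣ k ∣ ℕ.* 2) ℕ.% 2      ≡⟨ ℕ.m*n%n≡0 ∣ k ∣ 2 ⟩
      0                        ∎

  quadratic : Carrier → Carrier → Carrier → Carrier → Carrier
  quadratic a b c x = c +ᶠ b *ᶠ x +ᶠ a *ᶠ (x *ᶠ x)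

  module _ (a b c : Carrier) (c≢0 : c ≢ 0#) where

    private
      g : Carrier → Carrier
      g = quadratic a b c

    -- Dividing g by x - x₀ leaves the linear factor a x + (a x₀ + b).
    module _ (x₀ : Carrier) (root : g x₀ ≡ 0#) where

      private
        b′ : Carrier
        b′ = a *ᶠ x₀ +ᶠ b

        factor : ∀ x → g x ≡ (x -ᶠ x₀) *ᶠ (a *ᶠ x +ᶠ b′)
        factor x = begin
          g x
            ≡⟨ solve 5 (λ a b c x y → c :+ b :* x :+ a :* (x :* x)
                 := (x :+ :- y) :* (a :* x :+ (a :* y :+ b)) :+ (c :+ b :* y :+ a :* (y :* y))) refl a b c x x₀ ⟩
          (x -ᶠ x₀) *ᶠ (a *ᶠ x +ᶠ b′) +ᶠ g x₀
            ≡⟨ trans (cong (_+ᶠ_ _) root) (+ᶠ-identityʳ _) ⟩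
          (x -ᶠ x₀) *ᶠ (a *ᶠ x +ᶠ b′) ∎

        split : ∀ x → δ (g x) ≤ 𝟙 (x ≟ᶠ x₀) + δ (a *ᶠ x +ᶠ b′)
        split x with x ≟ᶠ x₀
        ... | yes refl = subst (_≤ 1ℤ + δ (a *ᶠ x +ᶠ b′)) (sym (δ-zero root))
                           (+-monoʳ-≤ 1ℤ (𝟙-nonneg (a *ᶠ x +ᶠ b′ ≟ᶠ 0#)))
        ... | no x≢x₀ = ≤-reflexive (begin
          δ (g x)                               ≡⟨ cong δ (factor x) ⟩
          δ ((x -ᶠ x₀) *ᶠ (a *ᶠ x +ᶠ b′))       ≡⟨ δ-* (x≢x₀ ∘ x-y≡0⇒x≡y) _ ⟩
          δ (a *ᶠ x +ᶠ b′)                      ≡⟨ +-identityˡ _ ⟨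
          0ℤ + δ (a *ᶠ x +ᶠ b′)                 ∎)

        -- The cofactor has one zero unless it is constant. If it were identically zero, then `g`
        -- would be too, and its constant term `c` would vanish; this is where `c≢0` enters.
        linear : Dec (a ≡ 0#) → ∑[ x ← elements ] δ (a *ᶠ x +ᶠ b′) ≤ 1ℤ
        linear (no a≢0)  = ≤-reflexive (∑δ-affine a≢0 b′)
        linear (yes a≡0) = subst (_≤ 1ℤ) (sym (trans (∑-cong elements (λ x → δ-nonzero (nonzero x))) (∑-zero elements)))
                             (+≤+ ℕ.z≤n)
          where
          nonzero : ∀ x → a *ᶠ x +ᶠ b′ ≢ 0#
          nonzero x eq = c≢0 (begin
            c
              ≡⟨ solve 5 (λ a b c x y → c := (c :+ b :* y :+ a :* (y :* y)) :+ :- (y :* (a :* x :+ (a :* y :+ b))) :+ a :* (x :* y)) refl a b c x x₀ ⟩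
            g x₀ -ᶠ x₀ *ᶠ (a *ᶠ x +ᶠ b′) +ᶠ a *ᶠ (x *ᶠ x₀)
              ≡⟨ cong₂ _+ᶠ_ (cong₂ (λ s t → s -ᶠ x₀ *ᶠ t) root eq) (cong (_*ᶠ (x *ᶠ x₀)) a≡0) ⟩
            0# -ᶠ x₀ *ᶠ 0# +ᶠ 0# *ᶠ (x *ᶠ x₀)
              ≡⟨ solve 2 (λ x y → con 0ℤ :+ :- (y :* con 0ℤ) :+ con 0ℤ :* (x :* y) := con 0ℤ) refl x x₀ ⟩
            0# ∎)

      roots≤2-given-root : ∑[ x ← elements ] δ (g x) ≤ + 2
      roots≤2-given-root = ≤-trans (∑-mono elements split)
        (subst (_≤ + 2) (sym (trans (∑-+ elements _ _) (cong (_+ (∑[ x ← elements ] δ (a *ᶠ x +ᶠ b′))) (count-∈ _≟ᶠ_ elements-unique (elements-complete x₀)))))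
          (+-monoʳ-≤ 1ℤ (linear (a ≟ᶠ 0#))))

    roots≤2 : ∑[ x ← elements ] δ (g x) ≤ + 2
    roots≤2 with Any.any? (λ x → g x ≟ᶠ 0#) elements
    ... | yes any = let x₀ , root = Any.satisfied any in roots≤2-given-root x₀ root
    ... | no none = subst (_≤ + 2)
                      (sym (trans (∑-cong elements (λ x → δ-nonzero (none ∘ lose (elements-complete x)))) (∑-zero elements)))
                      (+≤+ ℕ.z≤n)

-- Value distribution of quadratic forms, by adding hyperbolic planes.

module QuadraticForms (F : FiniteField) where

  open FiniteField F renaming (_+_ to _+ᶠ_; _*_ to _*ᶠ_; -_ to -ᶠ_; _≟_ to infix 4 _≟ᶠ_)
  open FieldSolver F using (solve; _:=_; _:+_; _:*_; :-_; con) renaming (+-identityˡ to +ᶠ-identityˡ)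
  open FieldCounting F
  open Sums
  open import Data.Integer hiding (_⊖_; _≟_; suc)
  open import Data.Integer.Properties hiding (_≟_)
  open import Data.Integer.Tactic.RingSolver using (solve-∀)
  open import Data.Nat using (ℕ; zero; suc)
  open ≡-Reasoning

  -- Unlike `2 * n`, this unfolds to two successors by definition, so vectors of length
  -- `double (suc n)` can be matched as `a ∷ b ∷ v`.
  double : ℕ → ℕ
  double zero    = zero
  double (suc n) = suc (suc (double n))

  vectors : ∀ d → List (Vec Carrier d)
  vectors zero    = [] ∷ []
  vectors (suc d) = cartesianProductWith _∷_ elements (vectors d)

  vectors-complete : ∀ {d} (v : Vec Carrier d) → v ∈ vectors d
  vectors-complete []      = here refl
  vectors-complete (a ∷ v) = ∈-cartesianProductWith⁺ _∷_ (elements-complete a) (vectors-complete v)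

  vectors-unique : ∀ d → Unique (vectors d)
  vectors-unique zero    = [] ∷ []
  vectors-unique (suc d) = cartesianProductWith⁺ _∷_ ∷-injective elements-unique (vectors-unique d)

  _≟ᵛ_ : ∀ {d} → DecidableEquality (Vec Carrier d)
  _≟ᵛ_ = ≡-dec _≟ᶠ_

  ∑-vectors₂ : ∀ d (f : Vec Carrier (suc (suc d)) → ℤ) →
    ∑ (vectors (suc (suc d))) f ≡ ∑[ a ← elements ] ∑[ b ← elements ] ∑[ v ← vectors d ] f (a ∷ b ∷ v)
  ∑-vectors₂ d f = trans (∑-cartesianProductWith _∷_ elements (vectors (suc d)) f)
    (∑-cong elements λ a → ∑-cartesianProductWith _∷_ elements (vectors d) (f ∘ (a ∷_)))

  ∑-vectors-const : ∀ d → ∑[ v ← vectors d ] 1ℤ ≡ q ^ d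
  ∑-vectors-const zero    = refl
  ∑-vectors-const (suc d) = begin
    ∑[ v ← vectors (suc d) ] 1ℤ                   ≡⟨ ∑-cartesianProductWith _∷_ elements (vectors d) _ ⟩
    ∑[ a ← elements ] ∑[ v ← vectors d ] 1ℤ       ≡⟨ ∑-const elements _ ⟩
    q * (∑[ v ← vectors d ] 1ℤ)                   ≡⟨ cong (q *_) (∑-vectors-const d) ⟩
    q * q ^ d                                     ∎

  scale : ∀ {d} → Carrier → Vec Carrier d → Vec Carrier d
  scale l = Vec.map (l *ᶠ_)

  𝟎 : ∀ {d} → Vec Carrier d
  𝟎 = replicate _ 0#

  -- σ is 1 for hyperbolic and -1 for elliptic forms.
  record IsForm (σ : ℤ) (n : ℕ) (Q : Vec Carrier (double n) → Carrier) : Set where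
    field
      B             : Vec Carrier (double n) → Vec Carrier (double n) → Carrier
      expand        : ∀ u w l → Q (u ⊖ scale l w) ≡ Q u -ᶠ l *ᶠ B u w +ᶠ l *ᶠ l *ᶠ Q w
      -- Non-degeneracy in the shape needed for counting: each functional `B _ w` with `w` non-zero
      -- takes all values equally often. Here and in `count` the factor q avoids the exponents 2n -
      -- 1 and n - 1, which would be truncated at n = 0.
      nondegenerate : ∀ w → w ≢ 𝟎 → ∀ c → q * (∑[ u ← vectors (double n) ] δ (B u w -ᶠ c)) ≡ q ^ double n
      count         : ∀ r → q * (∑[ u ← vectors (double n) ] δ (Q u -ᶠ r))
                            ≡ q ^ double n + σ * (q * δ r - 1ℤ) * q ^ n

  module _ {σ n} {Q : Vec Carrier (double (suc n)) → Carrier} {Q′ : Vec Carrier (double n) → Carrier}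
           (split : ∀ a b v → Q (a ∷ b ∷ v) ≡ a *ᶠ b +ᶠ Q′ v) (form : IsForm σ n Q′) where

    private
      module Q′ = IsForm form

      d : ℕ
      d = double n

      -- An equation that determines one coordinate `y` uniquely has one solution for each choice of
      -- the remaining coordinates.
      ones : ∀ (f : Carrier → Vec Carrier d → Carrier → ℤ) →
        (∀ x v → ∑[ y ← elements ] f x v y ≡ 1ℤ) →
        ∑[ x ← elements ] ∑[ v ← vectors d ] ∑[ y ← elements ] f x v y ≡ q * q ^ d
      ones f eq = begin
        ∑[ x ← elements ] ∑[ v ← vectors d ] ∑[ y ← elements ] f x v y
          ≡⟨ ∑-cong elements (λ x → trans (∑-cong (vectors d) (eq x)) (∑-vectors-const d)) ⟩
        ∑[ x ← elements ] q ^ d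
          ≡⟨ ∑-const elements (q ^ d) ⟩
        q * q ^ d ∎

      B : Vec Carrier (double (suc n)) → Vec Carrier (double (suc n)) → Carrier
      B (a ∷ b ∷ v) (a′ ∷ b′ ∷ v′) = a *ᶠ b′ +ᶠ b *ᶠ a′ +ᶠ Q′.B v v′

      expand : ∀ u w l → Q (u ⊖ scale l w) ≡ Q u -ᶠ l *ᶠ B u w +ᶠ l *ᶠ l *ᶠ Q w
      expand u@(a ∷ b ∷ v) w@(a′ ∷ b′ ∷ v′) l = begin
        Q (u ⊖ scale l w)
          ≡⟨ split _ _ _ ⟩
        (a -ᶠ l *ᶠ a′) *ᶠ (b -ᶠ l *ᶠ b′) +ᶠ Q′ (v ⊖ scale l v′)
          ≡⟨ cong (_+ᶠ_ _) (Q′.expand v v′ l) ⟩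
        (a -ᶠ l *ᶠ a′) *ᶠ (b -ᶠ l *ᶠ b′) +ᶠ (Q′ v -ᶠ l *ᶠ Q′.B v v′ +ᶠ l *ᶠ l *ᶠ Q′ v′)
          ≡⟨ solve 8 (λ a b a′ b′ l x y z →
               (a :+ :- (l :* a′)) :* (b :+ :- (l :* b′)) :+ (x :+ :- (l :* y) :+ l :* l :* z)
               := (a :* b :+ x) :+ :- (l :* (a :* b′ :+ b :* a′ :+ y)) :+ l :* l :* (a′ :* b′ :+ z))
               refl a b a′ b′ l (Q′ v) (Q′.B v v′) (Q′ v′) ⟩
        (a *ᶠ b +ᶠ Q′ v) -ᶠ l *ᶠ B u w +ᶠ l *ᶠ l *ᶠ (a′ *ᶠ b′ +ᶠ Q′ v′)
          ≡⟨ cong₂ (λ x y → x -ᶠ l *ᶠ B u w +ᶠ l *ᶠ l *ᶠ y) (split a b v) (split a′ b′ v′) ⟨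
        Q u -ᶠ l *ᶠ B u w +ᶠ l *ᶠ l *ᶠ Q w ∎

      -- A non-zero `b′` lets the equation be solved for `a`, a non-zero `a′` for `b`. If both
      -- vanish, the functional depends on `v` alone, `v′` is non-zero, and the smaller form takes
      -- over.
      nondegenerate : ∀ w → w ≢ 𝟎 → ∀ c →
        q * (∑[ u ← vectors (double (suc n)) ] δ (B u w -ᶠ c)) ≡ q ^ double (suc n)
      nondegenerate (a′ ∷ b′ ∷ v′) w≢𝟎 c =
        cong (q *_) (trans (∑-vectors₂ d _) (by-cases (a′ ≟ᶠ 0#) (b′ ≟ᶠ 0#)))
        where
        f : Carrier → Carrier → Vec Carrier d → ℤ
        f a b v = δ (a *ᶠ b′ +ᶠ b *ᶠ a′ +ᶠ Q′.B v v′ -ᶠ c)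

        by-cases : Dec (a′ ≡ 0#) → Dec (b′ ≡ 0#) →
          ∑[ a ← elements ] ∑[ b ← elements ] ∑[ v ← vectors d ] f a b v ≡ q * q ^ d
        by-cases _ (no b′≢0) = begin
          ∑[ a ← elements ] ∑[ b ← elements ] ∑[ v ← vectors d ] f a b v
            ≡⟨ ∑-swap elements elements _ ⟩
          ∑[ b ← elements ] ∑[ a ← elements ] ∑[ v ← vectors d ] f a b v
            ≡⟨ ∑-cong elements (λ b → ∑-swap elements (vectors d) _) ⟩
          ∑[ b ← elements ] ∑[ v ← vectors d ] ∑[ a ← elements ] f a b v
            ≡⟨ ones (λ b v a → f a b v) (λ b v → trans
                 (∑-cong elements λ a → cong δ (solve 6 (λ a b a′ b′ x c →
                   a :* b′ :+ b :* a′ :+ x :+ :- c := b′ :* a :+ (b :* a′ :+ x :+ :- c)) refl a b a′ b′ (Q′.B v v′) c))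
                 (∑δ-affine b′≢0 _)) ⟩
          q * q ^ d ∎
        by-cases (no a′≢0) (yes _) = begin
          ∑[ a ← elements ] ∑[ b ← elements ] ∑[ v ← vectors d ] f a b v
            ≡⟨ ∑-cong elements (λ a → ∑-swap elements (vectors d) _) ⟩
          ∑[ a ← elements ] ∑[ v ← vectors d ] ∑[ b ← elements ] f a b v
            ≡⟨ ones (λ a v b → f a b v) (λ a v → trans
                 (∑-cong elements λ b → cong δ (solve 6 (λ a b a′ b′ x c →
                   a :* b′ :+ b :* a′ :+ x :+ :- c := a′ :* b :+ (a :* b′ :+ x :+ :- c)) refl a b a′ b′ (Q′.B v v′) c))
                 (∑δ-affine a′≢0 _)) ⟩
          q * q ^ d ∎
        by-cases (yes refl) (yes refl) = begin
          ∑[ a ← elements ] ∑[ b ← elements ] ∑[ v ← vectors d ] f a b v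
            ≡⟨ ∑-cong elements (λ a → ∑-cong elements λ b → ∑-cong (vectors d) λ v → cong δ
                 (solve 4 (λ a b x c → a :* con 0ℤ :+ b :* con 0ℤ :+ x :+ :- c := x :+ :- c) refl a b (Q′.B v v′) c)) ⟩
          ∑[ a ← elements ] ∑[ b ← elements ] ∑[ v ← vectors d ] δ (Q′.B v v′ -ᶠ c)
            ≡⟨ trans (∑-cong elements λ a → ∑-const elements _) (∑-const elements _) ⟩
          q * (q * (∑[ v ← vectors d ] δ (Q′.B v v′ -ᶠ c)))
            ≡⟨ cong (q *_) (Q′.nondegenerate v′ (λ { refl → w≢𝟎 refl }) c) ⟩
          q * q ^ d ∎

      -- A non-zero `a` determines `b` from `v`, while `a ≡ 0#` leaves `b` free and requires
      -- `Q′ v ≡ r`. Only that second fibre deviates from the average, so the deviation of `Q′` is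
      -- inherited with the sign σ unchanged.
      count : ∀ r → q * (∑[ u ← vectors (double (suc n)) ] δ (Q u -ᶠ r))
                    ≡ q ^ double (suc n) + σ * (q * δ r - 1ℤ) * q ^ suc n
      count r = begin
        q * (∑[ u ← vectors (double (suc n)) ] δ (Q u -ᶠ r))
          ≡⟨ cong (q *_) (trans (∑-vectors₂ d _) (trans (∑-cong elements fibre) (∑-+ elements _ _))) ⟩
        q * (∑[ a ← elements ] D + ∑[ a ← elements ] δ a * (q * N - D))
          ≡⟨ cong₂ (λ x y → q * (x + y)) (∑-const elements D) δ-sum ⟩
        q * (q * D + (q * N - D))
          ≡⟨ cong (λ x → q * (q * D + (x - D))) (Q′.count r) ⟩
        q * (q * D + (D + σ * (q * δ r - 1ℤ) * q ^ n - D))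
          ≡⟨ rearrange q D σ (δ r) (q ^ n) ⟩
        q * (q * D) + σ * (q * δ r - 1ℤ) * (q * q ^ n) ∎
        where
        D N : ℤ
        D = q ^ d
        N = ∑[ v ← vectors d ] δ (Q′ v -ᶠ r)

        rearrange : ∀ q D s e p →
          q * (q * D + (D + s * (q * e - 1ℤ) * p - D)) ≡ q * (q * D) + s * (q * e - 1ℤ) * (q * p)
        rearrange = solve-∀

        δ-sum : ∑[ a ← elements ] δ a * (q * N - D) ≡ q * N - D
        δ-sum = ∑-δ _≟ᶠ_ elements-unique (elements-complete 0#) (λ _ → q * N - D)

        fibre : ∀ a → ∑[ b ← elements ] ∑[ v ← vectors d ] δ (Q (a ∷ b ∷ v) -ᶠ r) ≡ D + δ a * (q * N - D)
        fibre a with a ≟ᶠ 0#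
        ... | yes refl = begin
          ∑[ b ← elements ] ∑[ v ← vectors d ] δ (Q (0# ∷ b ∷ v) -ᶠ r)
            ≡⟨ ∑-cong elements (λ b → ∑-cong (vectors d) λ v → cong (λ x → δ (x -ᶠ r)) (trans (split 0# b v)
                 (solve 2 (λ b x → con 0ℤ :* b :+ x := x) refl b (Q′ v)))) ⟩
          ∑[ b ← elements ] N
            ≡⟨ ∑-const elements N ⟩
          q * N
            ≡⟨ cancel D (q * N) ⟩
          D + 1ℤ * (q * N - D) ∎
          where
          cancel : ∀ D x → x ≡ D + 1ℤ * (x - D)
          cancel = solve-∀
        ... | no a≢0 = begin
          ∑[ b ← elements ] ∑[ v ← vectors d ] δ (Q (a ∷ b ∷ v) -ᶠ r)
            ≡⟨ ∑-swap elements (vectors d) _ ⟩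
          ∑[ v ← vectors d ] ∑[ b ← elements ] δ (Q (a ∷ b ∷ v) -ᶠ r)
            ≡⟨ ∑-cong (vectors d) (λ v → trans
                 (∑-cong elements λ b → cong δ (trans (cong (_-ᶠ r) (split a b v))
                   (solve 4 (λ a b x r → a :* b :+ x :+ :- r := a :* b :+ (x :+ :- r)) refl a b (Q′ v) r)))
                 (∑δ-affine a≢0 _)) ⟩
          ∑[ v ← vectors d ] 1ℤ
            ≡⟨ ∑-vectors-const d ⟩
          D
            ≡⟨ trans (cong (_+_ D) (*-zeroˡ (q * N - D))) (+-identityʳ D) ⟨
          D + 0ℤ * (q * N - D) ∎

    addHyperbolicPlane : IsForm σ (suc n) Q
    addHyperbolicPlane = record { B = B ; expand = expand ; nondegenerate = nondegenerate ; count = count }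

  Q₁-isForm : ∀ n → IsForm 1ℤ n Q₁
  -- A single vector of value 0 already satisfies the hyperbolic formula at n = 0, so the induction
  -- starts in dimension 0.
  Q₁-isForm zero = record
    { B = λ _ _ → 0#
    ; expand = λ { [] [] l → solve 1 (λ l → con 0ℤ := con 0ℤ :+ :- (l :* con 0ℤ) :+ l :* l :* con 0ℤ) refl l }
    ; nondegenerate = λ { [] []≢[] → contradiction refl []≢[] }
    ; count = λ r → begin
        q * (δ (0# -ᶠ r) + 0ℤ)                   ≡⟨ cong (λ x → q * (x + 0ℤ)) (trans (cong δ (+ᶠ-identityˡ _)) (δ-neg r)) ⟩
        q * (δ r + 0ℤ)                           ≡⟨ rearrange q (δ r) ⟩
        1ℤ + 1ℤ * (q * δ r - 1ℤ) * 1ℤ            ∎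
    }
    where
    rearrange : ∀ q e → q * (e + 0ℤ) ≡ 1ℤ + 1ℤ * (q * e - 1ℤ) * 1ℤ
    rearrange = solve-∀
  Q₁-isForm (suc n) = addHyperbolicPlane (λ _ _ _ → refl) (Q₁-isForm n)

-- The anisotropic binary form and the elliptic family.

module Conic (F : FiniteField) where

  open FiniteField F renaming (_+_ to _+ᶠ_; _*_ to _*ᶠ_; -_ to -ᶠ_; _≟_ to infix 4 _≟ᶠ_)
  open FieldSolver F using (solve; _:=_; _:+_; _:*_; :-_; con)
    renaming (*-identityˡ to *ᶠ-identityˡ; zeroˡ to zeroˡᶠ)
  open FieldCounting F
  open QuadraticForms F
  open Sums
  open import Data.Integer hiding (_⊖_; _≟_; suc)
  open import Data.Integer.Properties hiding (_≟_)
  open import Data.Integer.Tactic.RingSolver using (solve-∀)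
  open import Data.Nat as ℕ using (zero; suc)
  open ≡-Reasoning

  module _ {ε : Carrier} (ε-nonSquare : NonSquare ε) where

    -- The norm of a + b√ε in the quadratic extension of the field; the extension itself is never
    -- built.
    norm : Carrier → Carrier → Carrier
    norm a b = a *ᶠ a -ᶠ ε *ᶠ (b *ᶠ b)

    -- With `b` invertible, a zero of the norm would exhibit ε as the square of a/b.
    norm-anisotropicʳ : ∀ {a b} → norm a b ≡ 0# → b ≡ 0#
    norm-anisotropicʳ {a} {b} eq with b ≟ᶠ 0#
    ... | yes b≡0 = b≡0
    ... | no b≢0 with inverse b b≢0
    ...   | b⁻¹ , b*b⁻¹≡1 = contradiction (begin
      (a *ᶠ b⁻¹) *ᶠ (a *ᶠ b⁻¹)
        ≡⟨ solve 4 (λ a b i e → (a :* i) :* (a :* i)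
             := (a :* a :+ :- (e :* (b :* b))) :* (i :* i) :+ e :* ((b :* i) :* (b :* i))) refl a b b⁻¹ ε ⟩
      norm a b *ᶠ (b⁻¹ *ᶠ b⁻¹) +ᶠ ε *ᶠ ((b *ᶠ b⁻¹) *ᶠ (b *ᶠ b⁻¹))
        ≡⟨ cong₂ (λ x y → x *ᶠ (b⁻¹ *ᶠ b⁻¹) +ᶠ ε *ᶠ (y *ᶠ y)) eq b*b⁻¹≡1 ⟩
      0# *ᶠ (b⁻¹ *ᶠ b⁻¹) +ᶠ ε *ᶠ (1# *ᶠ 1#)
        ≡⟨ solve 2 (λ i e → con 0ℤ :* (i :* i) :+ e :* (con 1ℤ :* con 1ℤ) := e) refl b⁻¹ ε ⟩
      ε ∎) (ε-nonSquare (a *ᶠ b⁻¹))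

    norm-anisotropicˡ : ∀ {a b} → norm a b ≡ 0# → a ≡ 0#
    norm-anisotropicˡ {a} {b} eq = a²≡0⇒a≡0 (begin
      a *ᶠ a                              ≡⟨ solve 2 (λ a e → a :* a := a :* a :+ :- (e :* (con 0ℤ :* con 0ℤ))) refl a ε ⟩
      norm a 0#                           ≡⟨ cong (norm a) (norm-anisotropicʳ eq) ⟨
      norm a b                            ≡⟨ eq ⟩
      0#                                  ∎)

    ε≢0 : ε ≢ 0#
    ε≢0 refl = ε-nonSquare 0# (zeroˡᶠ 0#)

    points : Carrier → ℤ
    points r = ∑[ v ← vectors 2 ] δ (Q₂ ε v -ᶠ r)

    points-double-sum : ∀ r → points r ≡ ∑[ a ← elements ] ∑[ b ← elements ] δ (norm a b -ᶠ r)
    points-double-sum r = trans (∑-vectors₂ 0 _)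
      (∑-cong elements λ a → ∑-cong elements λ b → +-identityʳ (δ (norm a b -ᶠ r)))

    points-0 : points 0# ≡ 1ℤ
    points-0 = begin
      points 0#
        ≡⟨ points-double-sum 0# ⟩
      ∑[ a ← elements ] ∑[ b ← elements ] δ (norm a b -ᶠ 0#)
        ≡⟨ ∑-cong elements (λ a → trans (∑-cong elements (product a)) (∑-*ˡ elements (δ a) δ)) ⟩
      ∑[ a ← elements ] δ a * (∑[ b ← elements ] δ b)
        ≡⟨ ∑-cong elements (λ a → trans (cong (δ a *_) ∑δ) (*-identityʳ (δ a))) ⟩
      ∑[ a ← elements ] δ a
        ≡⟨ ∑δ ⟩
      1ℤ ∎
      where
      zero-norm : norm 0# 0# -ᶠ 0# ≡ 0#
      zero-norm = solve 1 (λ e → con 0ℤ :* con 0ℤ :+ :- (e :* (con 0ℤ :* con 0ℤ)) :+ :- con 0ℤ := con 0ℤ) refl ε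

      product : ∀ a b → δ (norm a b -ᶠ 0#) ≡ δ a * δ b
      product a b with a ≟ᶠ 0# | b ≟ᶠ 0#
      ... | yes refl | yes refl = δ-zero zero-norm
      ... | no a≢0   | d        = trans (δ-nonzero (a≢0 ∘ norm-anisotropicˡ ∘ x-y≡0⇒x≡y)) (sym (*-zeroˡ (𝟙 d)))
      ... | yes _    | no b≢0   = δ-nonzero (b≢0 ∘ norm-anisotropicʳ ∘ x-y≡0⇒x≡y)

    module _ (2≢0 : 1# +ᶠ 1# ≢ 0#) where

      -- The points of norm 1 are parametrised as (1 + s, s t) by the slopes t of the lines through
      -- (1, 0); the term δ s accounts for (1, 0) itself.
      points-1-fibre : ∀ s →
        ∑[ b ← elements ] δ (norm (1# *ᶠ s +ᶠ 1#) b -ᶠ 1#)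
          ≡ δ s + (∑[ t ← elements ] δ (norm 1# t *ᶠ s +ᶠ (1# +ᶠ 1#)))
      points-1-fibre s with s ≟ᶠ 0#
      ... | yes refl = begin
        ∑[ b ← elements ] δ (norm (1# *ᶠ 0# +ᶠ 1#) b -ᶠ 1#)
          ≡⟨ ∑-cong elements only-zero ⟩
        ∑[ b ← elements ] δ b
          ≡⟨ ∑δ ⟩
        1ℤ + 0ℤ
          ≡⟨ cong (_+_ 1ℤ) (trans (∑-cong elements λ t → δ-nonzero (none t)) (∑-zero elements)) ⟨
        1ℤ + (∑[ t ← elements ] δ (norm 1# t *ᶠ 0# +ᶠ (1# +ᶠ 1#))) ∎
        where
        -- For `s ≡ 0#` the equation for the slope reads 2 = 0, so odd characteristic leaves only
        -- the point (1, 0) itself.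
        none : ∀ t → norm 1# t *ᶠ 0# +ᶠ (1# +ᶠ 1#) ≢ 0#
        none t eq = 2≢0 (trans (solve 1 (λ x → con 1ℤ :+ con 1ℤ := x :* con 0ℤ :+ (con 1ℤ :+ con 1ℤ)) refl (norm 1# t)) eq)
        only-zero : ∀ b → δ (norm (1# *ᶠ 0# +ᶠ 1#) b -ᶠ 1#) ≡ δ b
        only-zero b = begin
          δ (norm (1# *ᶠ 0# +ᶠ 1#) b -ᶠ 1#)
            ≡⟨ cong δ (solve 2 (λ b e → let a = con 1ℤ :* con 0ℤ :+ con 1ℤ in
                 (a :* a :+ :- (e :* (b :* b))) :+ :- con 1ℤ := :- (e :* (b :* b))) refl b ε) ⟩
          δ (-ᶠ (ε *ᶠ (b *ᶠ b)))
            ≡⟨ trans (δ-neg _) (δ-* ε≢0 _) ⟩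
          δ (b *ᶠ b)
            ≡⟨ 𝟙-⇔ a²≡0⇒a≡0 (λ { refl → zeroˡᶠ 0# }) (b *ᶠ b ≟ᶠ 0#) (b ≟ᶠ 0#) ⟩
          δ b ∎
      ... | no s≢0 = begin
        ∑[ b ← elements ] δ (norm (1# *ᶠ s +ᶠ 1#) b -ᶠ 1#)
          ≡⟨ ∑-affine s≢0 0# _ ⟨
        ∑[ t ← elements ] δ (norm (1# *ᶠ s +ᶠ 1#) (s *ᶠ t +ᶠ 0#) -ᶠ 1#)
          ≡⟨ ∑-cong elements (λ t → cong δ (solve 3 (λ s t e →
               let a = con 1ℤ :* s :+ con 1ℤ ; b = s :* t :+ con 0ℤ in
               (a :* a :+ :- (e :* (b :* b))) :+ :- con 1ℤ
               := s :* ((con 1ℤ :* con 1ℤ :+ :- (e :* (t :* t))) :* s :+ (con 1ℤ :+ con 1ℤ))) refl s t ε)) ⟩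
        ∑[ t ← elements ] δ (s *ᶠ (norm 1# t *ᶠ s +ᶠ (1# +ᶠ 1#)))
          ≡⟨ ∑-cong elements (λ t → δ-* s≢0 _) ⟩
        ∑[ t ← elements ] δ (norm 1# t *ᶠ s +ᶠ (1# +ᶠ 1#))
          ≡⟨ +-identityˡ _ ⟨
        0ℤ + (∑[ t ← elements ] δ (norm 1# t *ᶠ s +ᶠ (1# +ᶠ 1#))) ∎

      -- For each of the q slopes `t` the equation is linear in `s`, with leading coefficient
      -- `norm 1# t`, non-zero by anisotropy. Hence each slope yields one point, and (1, 0) is the
      -- extra one.
      points-1 : points 1# ≡ 1ℤ + q
      points-1 = begin
        points 1#
          ≡⟨ points-double-sum 1# ⟩
        ∑[ a ← elements ] ∑[ b ← elements ] δ (norm a b -ᶠ 1#)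
          ≡⟨ ∑-affine (0≢1 ∘ sym) 1# _ ⟨
        ∑[ s ← elements ] ∑[ b ← elements ] δ (norm (1# *ᶠ s +ᶠ 1#) b -ᶠ 1#)
          ≡⟨ trans (∑-cong elements points-1-fibre) (∑-+ elements δ _) ⟩
        ∑[ s ← elements ] δ s + ∑[ s ← elements ] ∑[ t ← elements ] δ (norm 1# t *ᶠ s +ᶠ (1# +ᶠ 1#))
          ≡⟨ cong₂ _+_ ∑δ (∑-swap elements elements _) ⟩
        1ℤ + (∑[ t ← elements ] ∑[ s ← elements ] δ (norm 1# t *ᶠ s +ᶠ (1# +ᶠ 1#)))
          ≡⟨ cong (_+_ 1ℤ) (trans (∑-cong elements λ t → ∑δ-affine (0≢1 ∘ sym ∘ norm-anisotropicˡ) _)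
                             (trans (∑-const elements 1ℤ) (*-identityʳ q))) ⟩
        1ℤ + q ∎

      -- Multiplication by a₀ + b₀√ε, an element of norm r, is a bijection that carries the points
      -- of norm 1 to those of norm r.
      points-represented : ∀ {r} → r ≢ 0# → ∀ a₀ b₀ → norm a₀ b₀ ≡ r → points r ≡ 1ℤ + q
      points-represented r≢0 a₀ b₀ refl with inverse (norm a₀ b₀) r≢0
      ... | r⁻¹ , r*r⁻¹≡1 = begin
        points (norm a₀ b₀)
          ≡⟨ ∑-reindex _≟ᵛ_ (vectors-unique 2) vectors-complete π π⁻¹ invʳ invˡ _ ⟨
        ∑[ v ← vectors 2 ] δ (Q₂ ε (π v) -ᶠ norm a₀ b₀)
          ≡⟨ ∑-cong (vectors 2) multiplicative ⟩
        points 1#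
          ≡⟨ points-1 ⟩
        1ℤ + q ∎
        where
        π π⁻¹ : Vec Carrier 2 → Vec Carrier 2
        π (a ∷ b ∷ [])   = (a₀ *ᶠ a +ᶠ ε *ᶠ (b₀ *ᶠ b)) ∷ (a₀ *ᶠ b +ᶠ b₀ *ᶠ a) ∷ []
        -- Multiplication by the conjugate a₀ - b₀√ε, divided by the norm.
        π⁻¹ (a ∷ b ∷ []) = r⁻¹ *ᶠ (a₀ *ᶠ a -ᶠ ε *ᶠ (b₀ *ᶠ b)) ∷ r⁻¹ *ᶠ (a₀ *ᶠ b -ᶠ b₀ *ᶠ a) ∷ []

        -- The ring solver knows nothing of r r⁻¹ = 1; its identities isolate this product as a
        -- factor, which is removed here.
        unit : ∀ {x y} → y ≡ (norm a₀ b₀ *ᶠ r⁻¹) *ᶠ x → y ≡ x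
        unit {x} eq = trans eq (trans (cong (_*ᶠ x) r*r⁻¹≡1) (*ᶠ-identityˡ x))

        invʳ : ∀ v → π (π⁻¹ v) ≡ v
        invʳ (a ∷ b ∷ []) = cong₂ (λ x y → x ∷ y ∷ [])
          (unit (solve 6 (λ a b c d e i →
            c :* (i :* (c :* a :+ :- (e :* (d :* b)))) :+ e :* (d :* (i :* (c :* b :+ :- (d :* a))))
            := (c :* c :+ :- (e :* (d :* d))) :* i :* a) refl a b a₀ b₀ ε r⁻¹))
          (unit (solve 6 (λ a b c d e i →
            c :* (i :* (c :* b :+ :- (d :* a))) :+ d :* (i :* (c :* a :+ :- (e :* (d :* b))))
            := (c :* c :+ :- (e :* (d :* d))) :* i :* b) refl a b a₀ b₀ ε r⁻¹))

        invˡ : ∀ v → π⁻¹ (π v) ≡ v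
        invˡ (a ∷ b ∷ []) = cong₂ (λ x y → x ∷ y ∷ [])
          (unit (solve 6 (λ a b c d e i →
            i :* (c :* (c :* a :+ e :* (d :* b)) :+ :- (e :* (d :* (c :* b :+ d :* a))))
            := (c :* c :+ :- (e :* (d :* d))) :* i :* a) refl a b a₀ b₀ ε r⁻¹))
          (unit (solve 6 (λ a b c d e i →
            i :* (c :* (c :* b :+ d :* a) :+ :- (d :* (c :* a :+ e :* (d :* b))))
            := (c :* c :+ :- (e :* (d :* d))) :* i :* b) refl a b a₀ b₀ ε r⁻¹))

        multiplicative : ∀ v → δ (Q₂ ε (π v) -ᶠ norm a₀ b₀) ≡ δ (Q₂ ε v -ᶠ 1#)
        multiplicative (a ∷ b ∷ []) = trans
          (cong δ (solve 5 (λ a b c d e →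
            let x = c :* a :+ e :* (d :* b) ; y = c :* b :+ d :* a ; r = c :* c :+ :- (e :* (d :* d)) in
            x :* x :+ :- (e :* (y :* y)) :+ :- r := r :* ((a :* a :+ :- (e :* (b :* b))) :+ :- con 1ℤ)) refl a b a₀ b₀ ε))
          (δ-* r≢0 _)

      -- Expected minus actual number of points of norm r: the expectation is 1 for r = 0 and q + 1
      -- otherwise. A value that is not represented would have deficit q + 1 and all others have 0;
      -- since the deficits sum to 0, every value is represented.
      deficit : Carrier → ℤ
      deficit r = 1ℤ + q - q * δ r - points r

      deficit-nonneg : ∀ r → 0ℤ ≤ deficit r
      deficit-nonneg r with r ≟ᶠ 0#
      ... | yes refl = ≤-reflexive (sym (trans (cong (λ p → 1ℤ + q - q * 1ℤ - p) points-0) (cancel q)))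
        where
        cancel : ∀ q → 1ℤ + q - q * 1ℤ - 1ℤ ≡ 0ℤ
        cancel = solve-∀
      ... | no r≢0 with Any.any? (λ v → Q₂ ε v -ᶠ r ≟ᶠ 0#) (vectors 2)
      ...   | yes represented = ≤-reflexive (sym (trans (cong (λ p → 1ℤ + q - q * 0ℤ - p) all) (cancel q)))
        where
        all : points r ≡ 1ℤ + q
        all with Any.satisfied represented
        ... | a ∷ b ∷ [] , eq = points-represented r≢0 a b (x-y≡0⇒x≡y eq)
        cancel : ∀ q → 1ℤ + q - q * 0ℤ - (1ℤ + q) ≡ 0ℤ
        cancel = solve-∀
      ...   | no none = subst (0ℤ ≤_) (sym (trans (cong (λ p → 1ℤ + q - q * 0ℤ - p) empty) (cancel q))) (+≤+ ℕ.z≤n)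
        where
        empty : points r ≡ 0ℤ
        empty = trans (∑-cong (vectors 2) λ v → δ-nonzero (none ∘ lose (vectors-complete v))) (∑-zero (vectors 2))
        cancel : ∀ q → 1ℤ + q - q * 0ℤ - 0ℤ ≡ 1ℤ + q
        cancel = solve-∀

      ∑-points : ∑[ r ← elements ] points r ≡ q * q
      ∑-points = begin
        ∑[ r ← elements ] points r
          ≡⟨ ∑-swap elements (vectors 2) _ ⟩
        ∑[ v ← vectors 2 ] ∑[ r ← elements ] δ (Q₂ ε v -ᶠ r)
          ≡⟨ ∑-cong (vectors 2) (λ v → trans (∑-cong elements λ r → trans (sym (𝟙-≟ (Q₂ ε v) r)) (𝟙-⇔ sym sym _ _))
               (count-∈ _≟ᶠ_ elements-unique (elements-complete (Q₂ ε v)))) ⟩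
        ∑[ v ← vectors 2 ] 1ℤ
          ≡⟨ ∑-vectors-const 2 ⟩
        q * (q * 1ℤ)
          ≡⟨ cong (q *_) (*-identityʳ q) ⟩
        q * q ∎

      ∑-deficit : ∑[ r ← elements ] deficit r ≡ 0ℤ
      ∑-deficit = begin
        ∑[ r ← elements ] deficit r
          ≡⟨ ∑-cong elements (λ r → regroup q (δ r) (points r)) ⟩
        ∑[ r ← elements ] (1ℤ + q + (- q * δ r + -1ℤ * points r))
          ≡⟨ trans (∑-+ elements _ _) (cong (_+_ (∑[ r ← elements ] (1ℤ + q))) (∑-+ elements _ _)) ⟩
        ∑[ r ← elements ] (1ℤ + q) + (∑[ r ← elements ] - q * δ r + ∑[ r ← elements ] -1ℤ * points r)
          ≡⟨ cong₂ _+_ (∑-const elements _) (cong₂ _+_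
               (trans (∑-*ˡ elements (- q) δ) (cong (- q *_) ∑δ))
               (trans (∑-*ˡ elements -1ℤ points) (cong (-1ℤ *_) ∑-points))) ⟩
        q * (1ℤ + q) + (- q * 1ℤ + -1ℤ * (q * q))
          ≡⟨ cancel q ⟩
        0ℤ ∎
        where
        regroup : ∀ q e p → 1ℤ + q - q * e - p ≡ 1ℤ + q + (- q * e + -1ℤ * p)
        regroup = solve-∀
        cancel : ∀ q → q * (1ℤ + q) + (- q * 1ℤ + -1ℤ * (q * q)) ≡ 0ℤ
        cancel = solve-∀

      norm-isForm : IsForm -1ℤ 1 (Q₂ ε)
      norm-isForm = record { B = B ; expand = expand ; nondegenerate = nondegenerate ; count = count }
        where
        B : Vec Carrier 2 → Vec Carrier 2 → Carrier
        -- The polar form 2 (a a′ - ε b b′), arranged as a linear form in `a` and `b`; its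
        -- coefficients are non-zero multiples of `a′` and `b′` because 2 and ε are non-zero.
        B (a ∷ b ∷ []) (a′ ∷ b′ ∷ []) = (1# +ᶠ 1#) *ᶠ a′ *ᶠ a +ᶠ -ᶠ ((1# +ᶠ 1#) *ᶠ (ε *ᶠ b′)) *ᶠ b

        expand : ∀ u w l → Q₂ ε (u ⊖ scale l w) ≡ Q₂ ε u -ᶠ l *ᶠ B u w +ᶠ l *ᶠ l *ᶠ Q₂ ε w
        expand (a ∷ b ∷ []) (a′ ∷ b′ ∷ []) l = solve 6 (λ a b c d l e →
          let x = a :+ :- (l :* c) ; y = b :+ :- (l :* d) ; two = con 1ℤ :+ con 1ℤ in
          x :* x :+ :- (e :* (y :* y))
          := (a :* a :+ :- (e :* (b :* b))) :+ :- (l :* (two :* c :* a :+ :- (two :* (e :* d)) :* b))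
             :+ l :* l :* (c :* c :+ :- (e :* (d :* d)))) refl a b a′ b′ l ε

        nondegenerate : ∀ w → w ≢ 𝟎 → ∀ c → q * (∑[ u ← vectors 2 ] δ (B u w -ᶠ c)) ≡ q ^ 2
        nondegenerate (a′ ∷ b′ ∷ []) w≢𝟎 c = begin
          q * (∑[ u ← vectors 2 ] δ (B u (a′ ∷ b′ ∷ []) -ᶠ c))
            ≡⟨ cong (q *_) (trans (∑-vectors₂ 0 _) (∑-cong elements λ a → ∑-cong elements λ b → +-identityʳ (f a b))) ⟩
          q * (∑[ a ← elements ] ∑[ b ← elements ] f a b)
            ≡⟨ cong (q *_) (by-cases (a′ ≟ᶠ 0#) (b′ ≟ᶠ 0#)) ⟩
          q * (q * 1ℤ) ∎
          where
          f : Carrier → Carrier → ℤ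
          f a b = δ ((1# +ᶠ 1#) *ᶠ a′ *ᶠ a +ᶠ -ᶠ ((1# +ᶠ 1#) *ᶠ (ε *ᶠ b′)) *ᶠ b -ᶠ c)

          by-cases : Dec (a′ ≡ 0#) → Dec (b′ ≡ 0#) → ∑[ a ← elements ] ∑[ b ← elements ] f a b ≡ q * 1ℤ
          by-cases (no a′≢0) _ = begin
            ∑[ a ← elements ] ∑[ b ← elements ] f a b
              ≡⟨ ∑-swap elements elements _ ⟩
            ∑[ b ← elements ] ∑[ a ← elements ] f a b
              ≡⟨ ∑-cong elements (λ b → trans
                   (∑-cong elements λ a → cong δ (solve 4 (λ x a y c → x :* a :+ y :+ :- c := x :* a :+ (y :+ :- c))
                     refl ((1# +ᶠ 1#) *ᶠ a′) a (-ᶠ ((1# +ᶠ 1#) *ᶠ (ε *ᶠ b′)) *ᶠ b) c))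
                   (∑δ-affine (a′≢0 ∘ a*b≡0⇒b≡0 2≢0) _)) ⟩
            ∑[ b ← elements ] 1ℤ
              ≡⟨ ∑-const elements 1ℤ ⟩
            q * 1ℤ ∎
          by-cases (yes _) (no b′≢0) = begin
            ∑[ a ← elements ] ∑[ b ← elements ] f a b
              ≡⟨ ∑-cong elements (λ a → trans
                   (∑-cong elements λ b → cong δ (solve 4 (λ x b y c → x :+ y :* b :+ :- c := y :* b :+ (x :+ :- c))
                     refl ((1# +ᶠ 1#) *ᶠ a′ *ᶠ a) b (-ᶠ ((1# +ᶠ 1#) *ᶠ (ε *ᶠ b′))) c))
                   (∑δ-affine (λ eq → b′≢0 (a*b≡0⇒b≡0 ε≢0 (a*b≡0⇒b≡0 2≢0 (-x≡0⇒x≡0 eq)))) _)) ⟩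
            ∑[ a ← elements ] 1ℤ
              ≡⟨ ∑-const elements 1ℤ ⟩
            q * 1ℤ ∎
            where
            -x≡0⇒x≡0 : ∀ {x} → -ᶠ x ≡ 0# → x ≡ 0#
            -x≡0⇒x≡0 {x} eq = x-y≡0⇒x≡y (begin
              x -ᶠ 0#                ≡⟨ solve 1 (λ x → x :+ :- con 0ℤ := :- (:- x)) refl x ⟩
              -ᶠ (-ᶠ x)              ≡⟨ cong -ᶠ_ eq ⟩
              -ᶠ 0#                  ≡⟨ solve 0 (:- con 0ℤ := con 0ℤ) refl ⟩
              0#                     ∎)
          by-cases (yes refl) (yes refl) = contradiction refl w≢𝟎

        count : ∀ r → q * points r ≡ q ^ 2 + -1ℤ * (q * δ r - 1ℤ) * q ^ 1
        count r = begin
          q * points r                                 ≡⟨ cong (q *_) (isolate q (δ r) (points r)) ⟩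
          q * (1ℤ + q - q * δ r - deficit r)           ≡⟨ cong (λ x → q * (1ℤ + q - q * δ r - x))
                                                            (∑-nonneg-zero elements deficit-nonneg ∑-deficit (elements-complete r)) ⟩
          q * (1ℤ + q - q * δ r - 0ℤ)                  ≡⟨ rearrange q (δ r) ⟩
          q ^ 2 + -1ℤ * (q * δ r - 1ℤ) * q ^ 1         ∎
          where
          isolate : ∀ q e p → p ≡ 1ℤ + q - q * e - (1ℤ + q - q * e - p)
          isolate = solve-∀
          rearrange : ∀ q e → q * (1ℤ + q - q * e - 0ℤ) ≡ q * (q * 1ℤ) + -1ℤ * (q * e - 1ℤ) * (q * 1ℤ)
          rearrange = solve-∀

      Q₂-isForm : ∀ n → IsForm -1ℤ (suc n) (Q₂ ε)
      Q₂-isForm zero    = norm-isForm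
      -- The hyperbolic clause of `Q₂` fires only when a third coordinate is visible, hence the
      -- pattern `c ∷ v`.
      Q₂-isForm (suc n) = addHyperbolicPlane (λ { a b (c ∷ v) → refl }) (Q₂-isForm n)

-- Correlations of pairs of spheres and the second moment.

module Correlation (F : FiniteField) where

  open FiniteField F renaming (_+_ to _+ᶠ_; _*_ to _*ᶠ_; -_ to -ᶠ_; _≟_ to infix 4 _≟ᶠ_)
  open FieldSolver F using (solve; _:=_; _:+_; _:*_; :-_; con) renaming (*-identityˡ to *ᶠ-identityˡ)
  open FieldCounting F
  open QuadraticForms F
  open Sums
  open import Data.Integer hiding (_⊖_; _≟_; suc)
  open import Data.Integer.Properties hiding (_≟_)
  open import Data.Integer.Tactic.RingSolver using (solve-∀)
  open import Data.Nat as ℕ using (zero; suc)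

  module _ where
    open ≡-Reasoning

    scale-1 : ∀ {d} (w : Vec Carrier d) → scale 1# w ≡ w
    scale-1 []      = refl
    scale-1 (a ∷ w) = cong₂ _∷_ (*ᶠ-identityˡ a) (scale-1 w)

    private
      ⊖-cancel : ∀ {d} (x y : Vec Carrier d) → zipWith _+ᶠ_ x y ⊖ y ≡ x
      ⊖-cancel []      []      = refl
      ⊖-cancel (a ∷ x) (b ∷ y) = cong₂ _∷_ (solve 2 (λ a b → a :+ b :+ :- b := a) refl a b) (⊖-cancel x y)

      cancel-⊖ : ∀ {d} (x y : Vec Carrier d) → zipWith _+ᶠ_ (x ⊖ y) y ≡ x
      cancel-⊖ []      []      = refl
      cancel-⊖ (a ∷ x) (b ∷ y) = cong₂ _∷_ (solve 2 (λ a b → a :+ :- b :+ b := a) refl a b) (cancel-⊖ x y)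

    ⊖-telescope : ∀ {d} (x y z : Vec Carrier d) → (x ⊖ y) ⊖ (z ⊖ y) ≡ x ⊖ z
    ⊖-telescope []      []      []      = refl
    ⊖-telescope (a ∷ x) (b ∷ y) (c ∷ z) = cong₂ _∷_
      (solve 3 (λ a b c → (a :+ :- b) :+ :- (c :+ :- b) := a :+ :- c) refl a b c) (⊖-telescope x y z)

    x⊖y≡𝟎⇒x≡y : ∀ {d} (x y : Vec Carrier d) → x ⊖ y ≡ 𝟎 → x ≡ y
    x⊖y≡𝟎⇒x≡y []      []      _  = refl
    x⊖y≡𝟎⇒x≡y (a ∷ x) (b ∷ y) eq with ∷-injective eq
    ... | a-b≡0 , x⊖y≡𝟎 = cong₂ _∷_ (x-y≡0⇒x≡y a-b≡0) (x⊖y≡𝟎⇒x≡y x y x⊖y≡𝟎)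

    ∑-translate : ∀ {d} (y : Vec Carrier d) f → ∑[ x ← vectors d ] f (x ⊖ y) ≡ ∑[ x ← vectors d ] f x
    ∑-translate {d} y f = ∑-reindex _≟ᵛ_ (vectors-unique d) vectors-complete
      (_⊖ y) (λ x → zipWith _+ᶠ_ x y) (λ x → ⊖-cancel x y) (λ x → cancel-⊖ x y) f

  1≤q : 1ℤ ≤ q
  1≤q = subst₂ _≤_ ∑δ (trans (∑-const elements 1ℤ) (*-identityʳ q)) (∑-mono elements λ x → 𝟙≤1 (x ≟ᶠ 0#))

  q^-nonneg : ∀ n → 0ℤ ≤ q ^ n
  q^-nonneg zero    = +≤+ ℕ.z≤n
  q^-nonneg (suc n) = *-nonneg {q} (+≤+ ℕ.z≤n) (q^-nonneg n)

  private
    -- Polynomial inequalities are proved by naming the difference `k` in a visibly non-negative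
    -- shape, which leaves an identity for the ring solver.
    ≤-by : ∀ {i j} k → 0ℤ ≤ k → j ≡ i + k → i ≤ j
    ≤-by {i} k 0≤k refl = i≤i+j i k ⦃ nonNegative 0≤k ⦄

    +-nonneg : ∀ {i j} → 0ℤ ≤ i → 0ℤ ≤ j → 0ℤ ≤ i + j
    +-nonneg = +-mono-≤

    0≤+ : ∀ {n} → 0ℤ ≤ + n
    0≤+ = +≤+ ℕ.z≤n

  module _ {σ n} {Q : Vec Carrier (double n) → Carrier} (form : IsForm σ n Q) where

    open IsForm form

    private
      V : List (Vec Carrier (double n))
      V = vectors (double n)

      D p : ℤ
      D = q ^ double n
      p = q ^ n

      0≤D : 0ℤ ≤ D
      0≤D = q^-nonneg (double n)

      0≤p : 0ℤ ≤ p
      0≤p = q^-nonneg n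

    χ : Sphere F (double n) → Vec Carrier (double n) → ℤ
    χ s x = 𝟙 (onSphere? F Q x s)

    correlation : (s t : Sphere F (double n)) → ℤ
    correlation s t = ∑[ x ← V ] (q * χ s x - 1ℤ) * (q * χ t x - 1ℤ)

    module _ where
      open ≡-Reasoning

      q*size : ∀ y r → q * ∑ V (χ (y , r)) ≡ D + σ * (q * δ r - 1ℤ) * p
      q*size y r = begin
        q * ∑ V (χ (y , r))
          ≡⟨ cong (q *_) (∑-cong V λ x → 𝟙-≟ (Q (x ⊖ y)) r) ⟩
        q * (∑[ x ← V ] δ (Q (x ⊖ y) -ᶠ r))
          ≡⟨ cong (q *_) (∑-translate y (λ u → δ (Q u -ᶠ r))) ⟩
        q * (∑[ u ← V ] δ (Q u -ᶠ r))
          ≡⟨ count r ⟩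
        D + σ * (q * δ r - 1ℤ) * p ∎

      correlation-expand : ∀ s t → correlation s t
        ≡ q * (q * (∑[ x ← V ] χ s x * χ t x)) - q * ∑ V (χ s) - q * ∑ V (χ t) + D
      correlation-expand s t = begin
        ∑[ x ← V ] (q * χ s x - 1ℤ) * (q * χ t x - 1ℤ)
          ≡⟨ ∑-cong V (λ x → multiply q (χ s x) (χ t x)) ⟩
        ∑[ x ← V ] (q * q * (χ s x * χ t x) + (- q * χ s x + (- q * χ t x + 1ℤ)))
          ≡⟨ trans (∑-+ V _ _) (cong (_+_ (∑[ x ← V ] q * q * (χ s x * χ t x)))
               (trans (∑-+ V _ _) (cong (_+_ (∑[ x ← V ] - q * χ s x)) (∑-+ V _ _)))) ⟩
        ∑[ x ← V ] q * q * (χ s x * χ t x) + (∑[ x ← V ] - q * χ s x + (∑[ x ← V ] - q * χ t x + ∑[ x ← V ] 1ℤ))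
          ≡⟨ cong₂ _+_ (∑-*ˡ V (q * q) _) (cong₂ _+_ (∑-*ˡ V (- q) _)
               (cong₂ _+_ (∑-*ˡ V (- q) _) (∑-vectors-const (double n)))) ⟩
        q * q * (∑[ x ← V ] χ s x * χ t x) + (- q * ∑ V (χ s) + (- q * ∑ V (χ t) + D))
          ≡⟨ regroup q (∑[ x ← V ] χ s x * χ t x) (∑ V (χ s)) (∑ V (χ t)) D ⟩
        q * (q * (∑[ x ← V ] χ s x * χ t x)) - q * ∑ V (χ s) - q * ∑ V (χ t) + D ∎
        where
        multiply : ∀ q a b → (q * a - 1ℤ) * (q * b - 1ℤ) ≡ q * q * (a * b) + (- q * a + (- q * b + 1ℤ))
        multiply = solve-∀
        regroup : ∀ q c a b d → q * q * c + (- q * a + (- q * b + d)) ≡ q * (q * c) - q * a - q * b + d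
        regroup = solve-∀

      -- The quadratic in `l` with value `r` at 0, value `r′` at 1 and leading coefficient `Qw`. Its
      -- constant term is `r`, so a non-zero radius is what `roots≤2` requires.
      pencilRadius : Carrier → Carrier → Carrier → Carrier → Carrier
      pencilRadius r r′ Qw = quadratic Qw (r′ -ᶠ r -ᶠ Qw) r

      -- The member Q(u) - r + l (Q(u - w) - r′ - Q(u) + r) of the pencil spanned by two spheres is the
      -- sphere of centre l w and radius pencilRadius l. A common point of the two spheres lies on all q
      -- members, any other point of their radical hyperplane on none, and every remaining point on one.
      intersection : ∀ w → w ≢ 𝟎 → ∀ r r′ →
        q * (q * (∑[ u ← V ] δ (Q u -ᶠ r) * δ (Q (u ⊖ w) -ᶠ r′)))
          ≡ D + σ * (q * (∑[ l ← elements ] δ (pencilRadius r r′ (Q w) l)) - q) * p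
      intersection w w≢𝟎 r r′ = begin
        q * (q * C)
          -- `D - M + q * C` is the number of incidences between points and pencil members; `M`, the
          -- size of the radical hyperplane, is known from non-degeneracy.
          ≡⟨ isolate q C D M ⟩
        q * (D - M + q * C) - q * D + q * M
          ≡⟨ cong₂ (λ x y → q * x - q * D + y) pencil (nondegenerate w w≢𝟎 c) ⟩
        q * (∑[ l ← elements ] N (g l)) - q * D + D
          ≡⟨ cong (λ x → x - q * D + D) members ⟩
        q * D + σ * (q * Z - q) * p - q * D + D
          ≡⟨ collect (q * D) (σ * (q * Z - q) * p) D ⟩
        D + σ * (q * Z - q) * p ∎
        where
        -- The radical hyperplane, where the two sphere equations agree, is given by `B u w ≡ c`.
        c : Carrier
        c = Q w +ᶠ r -ᶠ r′
        g : Carrier → Carrier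
        g = pencilRadius r r′ (Q w)
        X Y : Vec Carrier (double n) → Carrier
        X u = Q u -ᶠ r
        Y u = Q (u ⊖ w) -ᶠ r′
        N : Carrier → ℤ
        N a = ∑[ u ← V ] δ (Q u -ᶠ a)
        C M Z : ℤ
        C = ∑[ u ← V ] δ (X u) * δ (Y u)
        M = ∑[ u ← V ] δ (B u w -ᶠ c)
        Z = ∑[ l ← elements ] δ (g l)

        isolate : ∀ q C D M → q * (q * C) ≡ q * (D - M + q * C) - q * D + q * M
        isolate = solve-∀
        collect : ∀ a b d → a + b - a + d ≡ d + b
        collect = solve-∀

        expand₁ : ∀ u → Q (u ⊖ w) ≡ Q u -ᶠ 1# *ᶠ B u w +ᶠ 1# *ᶠ 1# *ᶠ Q w
        expand₁ u = trans (cong (λ v → Q (u ⊖ v)) (sym (scale-1 w))) (expand u w 1#)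

        member : ∀ l u → X u +ᶠ l *ᶠ (Y u -ᶠ X u) ≡ Q (u ⊖ scale l w) -ᶠ g l
        member l u = begin
          X u +ᶠ l *ᶠ (Y u -ᶠ X u)
            ≡⟨ cong (λ y → X u +ᶠ l *ᶠ (y -ᶠ r′ -ᶠ X u)) (expand₁ u) ⟩
          X u +ᶠ l *ᶠ (Q u -ᶠ 1# *ᶠ B u w +ᶠ 1# *ᶠ 1# *ᶠ Q w -ᶠ r′ -ᶠ X u)
            ≡⟨ solve 6 (λ x b y l r s →
                 (x :+ :- r) :+ l :* (x :+ :- (con 1ℤ :* b) :+ con 1ℤ :* con 1ℤ :* y :+ :- s :+ :- (x :+ :- r))
                 := (x :+ :- (l :* b) :+ l :* l :* y) :+ :- (r :+ (s :+ :- r :+ :- y) :* l :+ y :* (l :* l)))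
                 refl (Q u) (B u w) (Q w) l r r′ ⟩
          Q u -ᶠ l *ᶠ B u w +ᶠ l *ᶠ l *ᶠ Q w -ᶠ g l
            ≡⟨ cong (_-ᶠ g l) (expand u w l) ⟨
          Q (u ⊖ scale l w) -ᶠ g l ∎

        radical : ∀ u → X u -ᶠ Y u ≡ B u w -ᶠ c
        radical u = trans (cong (λ y → X u -ᶠ (y -ᶠ r′)) (expand₁ u))
          (solve 5 (λ x b y r s →
             (x :+ :- r) :+ :- (x :+ :- (con 1ℤ :* b) :+ con 1ℤ :* con 1ℤ :* y :+ :- s)
             := b :+ :- (y :+ r :+ :- s)) refl (Q u) (B u w) (Q w) r r′)

        pencil : D - M + q * C ≡ ∑[ l ← elements ] N (g l)
        pencil = begin
          D - M + q * C
            ≡⟨ cong₂ (λ x y → x + y + q * C) (∑-vectors-const (double n))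
                 (trans (∑-*ˡ V -1ℤ _) (-1*i≡-i M)) ⟨
          ∑[ u ← V ] 1ℤ + ∑[ u ← V ] -1ℤ * δ (B u w -ᶠ c) + q * C
            ≡⟨ cong₂ _+_ (∑-+ V _ _) (∑-*ˡ V q _) ⟨
          ∑[ u ← V ] (1ℤ + -1ℤ * δ (B u w -ᶠ c)) + ∑[ u ← V ] q * (δ (X u) * δ (Y u))
            ≡⟨ ∑-+ V _ _ ⟨
          ∑[ u ← V ] (1ℤ + -1ℤ * δ (B u w -ᶠ c) + q * (δ (X u) * δ (Y u)))
            ≡⟨ ∑-cong V (λ u → cong (λ x → 1ℤ + x + q * (δ (X u) * δ (Y u)))
                 (trans (-1*i≡-i _) (cong (λ x → - δ x) (sym (radical u))))) ⟩
          ∑[ u ← V ] (1ℤ - δ (X u -ᶠ Y u) + q * (δ (X u) * δ (Y u)))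
            ≡⟨ ∑-cong V (λ u → ∑δ-pencil (X u) (Y u)) ⟨
          ∑[ u ← V ] ∑[ l ← elements ] δ (X u +ᶠ l *ᶠ (Y u -ᶠ X u))
            ≡⟨ ∑-swap V elements _ ⟩
          ∑[ l ← elements ] ∑[ u ← V ] δ (X u +ᶠ l *ᶠ (Y u -ᶠ X u))
            ≡⟨ ∑-cong elements (λ l → trans (∑-cong V λ u → cong δ (member l u))
                 (∑-translate (scale l w) (λ u → δ (Q u -ᶠ g l)))) ⟩
          ∑[ l ← elements ] N (g l) ∎

        members : q * (∑[ l ← elements ] N (g l)) ≡ q * D + σ * (q * Z - q) * p
        members = begin
          q * (∑[ l ← elements ] N (g l))
            ≡⟨ ∑-*ˡ elements q _ ⟨
          ∑[ l ← elements ] q * N (g l)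
            ≡⟨ ∑-cong elements (λ l → trans (count (g l)) (regroup D σ q (δ (g l)) p)) ⟩
          ∑[ l ← elements ] (D - σ * p + σ * q * p * δ (g l))
            ≡⟨ trans (∑-+ elements _ _) (cong₂ _+_ (∑-const elements _) (∑-*ˡ elements (σ * q * p) _)) ⟩
          q * (D - σ * p) + σ * q * p * Z
            ≡⟨ rearrange q D σ p Z ⟩
          q * D + σ * (q * Z - q) * p ∎
          where
          regroup : ∀ D s q e p → D + s * (q * e - 1ℤ) * p ≡ D - s * p + s * q * p * e
          regroup = solve-∀
          rearrange : ∀ q D s p z → q * (D - s * p) + s * q * p * z ≡ q * D + s * (q * z - q) * p
          rearrange = solve-∀

      -- The intersection and the total contribute `D` each, the two sizes -`D` each, so only
      -- fluctuations are left. The centre `y` is moved to the origin in order to apply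
      -- `intersection`.
      correlation-distinct-centres : ∀ y z r r′ → y ≢ z → correlation (y , r) (z , r′)
        ≡ σ * p * (q * ((∑[ l ← elements ] δ (pencilRadius r r′ (Q (z ⊖ y)) l)) - 1ℤ - δ r - δ r′) + + 2)
      correlation-distinct-centres y z r r′ y≢z = begin
        correlation (y , r) (z , r′)
          ≡⟨ correlation-expand (y , r) (z , r′) ⟩
        q * (q * (∑[ x ← V ] χ (y , r) x * χ (z , r′) x)) - q * ∑ V (χ (y , r)) - q * ∑ V (χ (z , r′)) + D
          ≡⟨ cong₂ (λ a b → a - b - q * ∑ V (χ (z , r′)) + D)
               (trans (cong (λ i → q * (q * i)) moved) (intersection (z ⊖ y) (y≢z ∘ sym ∘ x⊖y≡𝟎⇒x≡y z y) r r′))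
               (q*size y r) ⟩
        D + σ * (q * Z - q) * p - (D + σ * (q * δ r - 1ℤ) * p) - q * ∑ V (χ (z , r′)) + D
          ≡⟨ cong (λ i → D + σ * (q * Z - q) * p - (D + σ * (q * δ r - 1ℤ) * p) - i + D) (q*size z r′) ⟩
        D + σ * (q * Z - q) * p - (D + σ * (q * δ r - 1ℤ) * p) - (D + σ * (q * δ r′ - 1ℤ) * p) + D
          ≡⟨ collect D σ q Z (δ r) (δ r′) p ⟩
        σ * p * (q * (Z - 1ℤ - δ r - δ r′) + + 2) ∎
        where
        Z : ℤ
        Z = ∑[ l ← elements ] δ (pencilRadius r r′ (Q (z ⊖ y)) l)

        collect : ∀ D s q Z a b p →
          D + s * (q * Z - q) * p - (D + s * (q * a - 1ℤ) * p) - (D + s * (q * b - 1ℤ) * p) + D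
            ≡ s * p * (q * (Z - 1ℤ - a - b) + + 2)
        collect = solve-∀

        moved : ∑[ x ← V ] χ (y , r) x * χ (z , r′) x
              ≡ ∑[ u ← V ] δ (Q u -ᶠ r) * δ (Q (u ⊖ (z ⊖ y)) -ᶠ r′)
        moved = trans
          (∑-cong V λ x → cong₂ _*_ (𝟙-≟ _ r)
            (trans (𝟙-≟ _ r′) (cong (λ v → δ (Q v -ᶠ r′)) (sym (⊖-telescope x y z)))))
          (∑-translate y (λ u → δ (Q u -ᶠ r) * δ (Q (u ⊖ (z ⊖ y)) -ᶠ r′)))

      -- The spheres are disjoint, so the main term survives as -`D`; the sign makes it harmless for
      -- an upper bound.
      correlation-concentric : ∀ y r r′ → r ≢ r′ →
        correlation (y , r) (y , r′) ≡ - D - σ * p * (q * (δ r + δ r′) - + 2)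
      correlation-concentric y r r′ r≢r′ = begin
        correlation (y , r) (y , r′)
          ≡⟨ correlation-expand (y , r) (y , r′) ⟩
        q * (q * (∑[ x ← V ] χ (y , r) x * χ (y , r′) x)) - q * ∑ V (χ (y , r)) - q * ∑ V (χ (y , r′)) + D
          ≡⟨ cong (λ i → q * (q * i) - q * ∑ V (χ (y , r)) - q * ∑ V (χ (y , r′)) + D)
               (trans (∑-cong V λ x → disjoint (Q (x ⊖ y) ≟ᶠ r) (Q (x ⊖ y) ≟ᶠ r′)) (∑-zero V)) ⟩
        q * (q * 0ℤ) - q * ∑ V (χ (y , r)) - q * ∑ V (χ (y , r′)) + D
          ≡⟨ cong₂ (λ a b → q * (q * 0ℤ) - a - b + D) (q*size y r) (q*size y r′) ⟩
        q * (q * 0ℤ) - (D + σ * (q * δ r - 1ℤ) * p) - (D + σ * (q * δ r′ - 1ℤ) * p) + D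
          ≡⟨ collect q D σ (δ r) (δ r′) p ⟩
        - D - σ * p * (q * (δ r + δ r′) - + 2) ∎
        where
        disjoint : ∀ {x} (d : Dec (x ≡ r)) (e : Dec (x ≡ r′)) → 𝟙 d * 𝟙 e ≡ 0ℤ
        disjoint (yes refl) (yes r≡r′) = contradiction r≡r′ r≢r′
        disjoint (yes _)    (no _)     = refl
        disjoint (no _)     e          = *-zeroˡ (𝟙 e)
        collect : ∀ q D s a b p →
          q * (q * 0ℤ) - (D + s * (q * a - 1ℤ) * p) - (D + s * (q * b - 1ℤ) * p) + D
            ≡ - D - s * p * (q * (a + b) - + 2)
        collect = solve-∀

      correlation-self : ∀ y r →
        correlation (y , r) (y , r) ≡ q * D - D + σ * p * (q - + 2) * (q * δ r - 1ℤ)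
      correlation-self y r = begin
        correlation (y , r) (y , r)
          ≡⟨ correlation-expand (y , r) (y , r) ⟩
        q * (q * (∑[ x ← V ] χ (y , r) x * χ (y , r) x)) - q * S - q * S + D
          ≡⟨ cong (λ i → q * (q * i) - q * S - q * S + D) (∑-cong V λ x → 𝟙-idem (Q (x ⊖ y) ≟ᶠ r)) ⟩
        q * (q * S) - q * S - q * S + D
          ≡⟨ cong (λ i → q * i - i - i + D) (q*size y r) ⟩
        q * E - E - E + D
          ≡⟨ collect q D σ (δ r) p ⟩
        q * D - D + σ * p * (q - + 2) * (q * δ r - 1ℤ) ∎
        where
        S E : ℤ
        S = ∑ V (χ (y , r))
        E = D + σ * (q * δ r - 1ℤ) * p
        collect : ∀ q D s a p → let e = D + s * (q * a - 1ℤ) * p in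
          q * e - e - e + D ≡ q * D - D + s * p * (q - + 2) * (q * a - 1ℤ)
        collect = solve-∀

    _≟ˢ_ : DecidableEquality (Sphere F (double n))
    _≟ˢ_ = ×-≡-dec _≟ᵛ_ _≟ᶠ_

    module _ {K : ℤ} where

      -- Pairs are sorted by equality of centres and then of radii; only the diagonal is granted the
      -- extra `q * D`, the order of the size of a sphere times q².
      correlation-≤ : (Radius : Carrier → Set) →
        (∀ y z r r′ → Radius r → Radius r′ → y ≢ z → correlation (y , r) (z , r′) ≤ K) →
        (∀ y r r′ → Radius r → Radius r′ → r ≢ r′ → correlation (y , r) (y , r′) ≤ K) →
        (∀ y r → Radius r → correlation (y , r) (y , r) ≤ K + q * D) →
        ∀ s t → Radius (proj₂ s) → Radius (proj₂ t) → correlation s t ≤ K + q * D * 𝟙 (t ≟ˢ s)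
      correlation-≤ Radius distinct concentric self (y , r) (z , r′) ρ ρ′ =
        by-cases (y ≟ᵛ z) (r ≟ᶠ r′) ((z , r′) ≟ˢ (y , r))
        where
        bound+ : ∀ d → 0ℤ ≤ q * D * 𝟙 {A = (z , r′) ≡ (y , r)} d
        bound+ d = *-nonneg (*-nonneg {q} 0≤+ 0≤D) (𝟙-nonneg d)

        by-cases : Dec (y ≡ z) → Dec (r ≡ r′) → (d : Dec ((z , r′) ≡ (y , r))) →
          correlation (y , r) (z , r′) ≤ K + q * D * 𝟙 d
        by-cases (yes refl) (yes refl) d = ≤-trans (self y r ρ)
          (≤-reflexive (cong (_+_ K) (trans (sym (*-identityʳ (q * D))) (cong (q * D *_) (sym (𝟙-true refl d))))))
        by-cases (yes refl) (no r≢r′) d = ≤-trans (concentric y r r′ ρ ρ′ r≢r′) (≤-by _ (bound+ d) refl)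
        by-cases (no y≢z)   _         d = ≤-trans (distinct y z r r′ ρ ρ′ y≢z) (≤-by _ (bound+ d) refl)

    -- The bound p (q + 2) is the hyperbolic value at Z = 2. In the elliptic case the worst
    -- possibility is Z = 0, which gives p (q - 2).
    correlation-≤-nonzero : σ ≡ 1ℤ ⊎ σ ≡ -1ℤ → ∀ s t → proj₂ s ≢ 0# → proj₂ t ≢ 0# →
      correlation s t ≤ p * (q + + 2) + q * D * 𝟙 (t ≟ˢ s)
    correlation-≤-nonzero σ≡±1 = correlation-≤ (_≢ 0#) distinct concentric self
      where
      0≤pq : 0ℤ ≤ p * q
      0≤pq = *-nonneg {p} {q} 0≤p 0≤+

      distinct : ∀ y z r r′ → r ≢ 0# → r′ ≢ 0# → y ≢ z → correlation (y , r) (z , r′) ≤ p * (q + + 2)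
      distinct y z r r′ r≢0 r′≢0 y≢z = subst (_≤ p * (q + + 2))
        (sym (trans (correlation-distinct-centres y z r r′ y≢z)
          (cong₂ (λ a b → σ * p * (q * (Z - 1ℤ - a - b) + + 2)) (δ-nonzero r≢0) (δ-nonzero r′≢0))))
        (by-sign σ≡±1)
        where
        Z : ℤ
        Z = ∑[ l ← elements ] δ (pencilRadius r r′ (Q (z ⊖ y)) l)
        0≤Z : 0ℤ ≤ Z
        0≤Z = ∑-nonneg elements λ l → 𝟙-nonneg (pencilRadius r r′ (Q (z ⊖ y)) l ≟ᶠ 0#)
        Z≤2 : Z ≤ + 2
        Z≤2 = roots≤2 (Q (z ⊖ y)) (r′ -ᶠ r -ᶠ Q (z ⊖ y)) r r≢0
        by-sign : ∀ {τ} → τ ≡ 1ℤ ⊎ τ ≡ -1ℤ → τ * p * (q * (Z - 1ℤ - 0ℤ - 0ℤ) + + 2) ≤ p * (q + + 2)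
        by-sign (inj₁ refl) = ≤-by (p * q * (+ 2 - Z)) (*-nonneg 0≤pq (i≤j⇒0≤j-i Z≤2)) (lem p q Z)
          where
          lem : ∀ p q Z → p * (q + + 2) ≡ 1ℤ * p * (q * (Z - 1ℤ - 0ℤ - 0ℤ) + + 2) + p * q * (+ 2 - Z)
          lem = solve-∀
        by-sign (inj₂ refl) = ≤-by (p * q * Z + + 4 * p) (+-nonneg (*-nonneg 0≤pq 0≤Z) (*-nonneg {+ 4} 0≤+ 0≤p)) (lem p q Z)
          where
          lem : ∀ p q Z → p * (q + + 2) ≡ -1ℤ * p * (q * (Z - 1ℤ - 0ℤ - 0ℤ) + + 2) + (p * q * Z + + 4 * p)
          lem = solve-∀

      concentric : ∀ y r r′ → r ≢ 0# → r′ ≢ 0# → r ≢ r′ → correlation (y , r) (y , r′) ≤ p * (q + + 2)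
      concentric y r r′ r≢0 r′≢0 r≢r′ = subst (_≤ p * (q + + 2))
        (sym (trans (correlation-concentric y r r′ r≢r′)
          (cong₂ (λ a b → - D - σ * p * (q * (a + b) - + 2)) (δ-nonzero r≢0) (δ-nonzero r′≢0))))
        (by-sign σ≡±1)
        where
        by-sign : ∀ {τ} → τ ≡ 1ℤ ⊎ τ ≡ -1ℤ → - D - τ * p * (q * (0ℤ + 0ℤ) - + 2) ≤ p * (q + + 2)
        by-sign (inj₁ refl) = ≤-by (D + p * q) (+-nonneg 0≤D 0≤pq) (lem D p q)
          where
          lem : ∀ D p q → p * (q + + 2) ≡ - D - 1ℤ * p * (q * (0ℤ + 0ℤ) - + 2) + (D + p * q)
          lem = solve-∀
        by-sign (inj₂ refl) = ≤-by (D + p * q + + 4 * p) (+-nonneg (+-nonneg 0≤D 0≤pq) (*-nonneg {+ 4} 0≤+ 0≤p)) (lem D p q)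
          where
          lem : ∀ D p q → p * (q + + 2) ≡ - D - -1ℤ * p * (q * (0ℤ + 0ℤ) - + 2) + (D + p * q + + 4 * p)
          lem = solve-∀

      self : ∀ y r → r ≢ 0# → correlation (y , r) (y , r) ≤ p * (q + + 2) + q * D
      self y r r≢0 = subst (_≤ p * (q + + 2) + q * D)
        (sym (trans (correlation-self y r)
          (cong (λ a → q * D - D + σ * p * (q - + 2) * (q * a - 1ℤ)) (δ-nonzero r≢0))))
        (by-sign σ≡±1)
        where
        by-sign : ∀ {τ} → τ ≡ 1ℤ ⊎ τ ≡ -1ℤ →
          q * D - D + τ * p * (q - + 2) * (q * 0ℤ - 1ℤ) ≤ p * (q + + 2) + q * D
        by-sign (inj₁ refl) = ≤-by (D + + 2 * (p * q)) (+-nonneg 0≤D (*-nonneg {+ 2} 0≤+ 0≤pq)) (lem D p q)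
          where
          lem : ∀ D p q → p * (q + + 2) + q * D ≡ q * D - D + 1ℤ * p * (q - + 2) * (q * 0ℤ - 1ℤ) + (D + + 2 * (p * q))
          lem = solve-∀
        by-sign (inj₂ refl) = ≤-by (D + + 4 * p) (+-nonneg 0≤D (*-nonneg {+ 4} 0≤+ 0≤p)) (lem D p q)
          where
          lem : ∀ D p q → p * (q + + 2) + q * D ≡ q * D - D + -1ℤ * p * (q - + 2) * (q * 0ℤ - 1ℤ) + (D + + 4 * p)
          lem = solve-∀

    private
      distinct-zero : ∀ y z → y ≢ z → correlation (y , 0#) (z , 0#)
        ≡ σ * p * (q * ((∑[ l ← elements ] δ (pencilRadius 0# 0# (Q (z ⊖ y)) l)) - + 3) + + 2)
      distinct-zero y z y≢z = trans (correlation-distinct-centres y z 0# 0# y≢z)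
        (trans (cong (λ a → σ * p * (q * (Z - 1ℤ - a - a) + + 2)) (δ-zero refl)) (lem σ p q Z))
        where
        Z : ℤ
        Z = ∑[ l ← elements ] δ (pencilRadius 0# 0# (Q (z ⊖ y)) l)
        lem : ∀ s p q Z → s * p * (q * (Z - 1ℤ - 1ℤ - 1ℤ) + + 2) ≡ s * p * (q * (Z - + 3) + + 2)
        lem = solve-∀

      self-zero : ∀ y → correlation (y , 0#) (y , 0#) ≡ q * D - D + σ * p * (q - + 2) * (q - 1ℤ)
      self-zero y = trans (correlation-self y 0#)
        (cong (λ a → q * D - D + σ * p * (q - + 2) * (a - 1ℤ)) (trans (cong (q *_) (δ-zero refl)) (*-identityʳ q)))

    -- The two spheres are themselves members of radius zero of their pencil, so Z ≥ 2.
    correlation-≤-zero-elliptic : σ ≡ -1ℤ → ∀ s t → proj₂ s ≡ 0# → proj₂ t ≡ 0# →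
      correlation s t ≤ p * (q + + 2) + q * D * 𝟙 (t ≟ˢ s)
    correlation-≤-zero-elliptic refl = correlation-≤ (_≡ 0#)
      (λ { y z _ _ refl refl → distinct y z })
      (λ { y r r′ refl refl r≢r′ → contradiction refl r≢r′ })
      (λ { y _ refl → self y })
      where
      distinct : ∀ y z → y ≢ z → correlation (y , 0#) (z , 0#) ≤ p * (q + + 2)
      distinct y z y≢z = subst (_≤ p * (q + + 2)) (sym (distinct-zero y z y≢z))
        (≤-by (p * q * (Z - + 2) + + 4 * p)
          (+-nonneg (*-nonneg (*-nonneg {p} {q} 0≤p 0≤+) (i≤j⇒0≤j-i 2≤Z)) (*-nonneg {+ 4} 0≤+ 0≤p)) (lem p q Z))
        where
        g : Carrier → Carrier
        g = pencilRadius 0# 0# (Q (z ⊖ y))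
        Z : ℤ
        Z = ∑[ l ← elements ] δ (g l)
        lem : ∀ p q Z → p * (q + + 2) ≡ -1ℤ * p * (q * (Z - + 3) + + 2) + (p * q * (Z - + 2) + + 4 * p)
        lem = solve-∀
        root-0 : g 0# ≡ 0#
        root-0 = solve 1 (λ w → con 0ℤ :+ (con 0ℤ :+ :- con 0ℤ :+ :- w) :* con 0ℤ :+ w :* (con 0ℤ :* con 0ℤ) := con 0ℤ)
          refl (Q (z ⊖ y))
        root-1 : g 1# ≡ 0#
        root-1 = solve 1 (λ w → con 0ℤ :+ (con 0ℤ :+ :- con 0ℤ :+ :- w) :* con 1ℤ :+ w :* (con 1ℤ :* con 1ℤ) := con 0ℤ)
          refl (Q (z ⊖ y))
        two-roots : ∀ l → 𝟙 (l ≟ᶠ 0#) + 𝟙 (l ≟ᶠ 1#) ≤ δ (g l)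
        two-roots l with l ≟ᶠ 0# | l ≟ᶠ 1#
        ... | yes refl | yes 0≡1  = contradiction 0≡1 0≢1
        ... | yes refl | no _     = ≤-reflexive (sym (δ-zero root-0))
        ... | no _     | yes refl = ≤-reflexive (sym (δ-zero root-1))
        ... | no _     | no _     = 𝟙-nonneg (g l ≟ᶠ 0#)
        2≤Z : + 2 ≤ Z
        2≤Z = subst (_≤ Z)
          (trans (∑-+ elements _ _) (cong₂ _+_ ∑δ (count-∈ _≟ᶠ_ elements-unique (elements-complete 1#))))
          (∑-mono elements two-roots)

      self : ∀ y → correlation (y , 0#) (y , 0#) ≤ p * (q + + 2) + q * D
      self y = subst (_≤ p * (q + + 2) + q * D) (sym (self-zero y))
        -- The difference contains p (q² - 2q + 4); completing the square shows that it is
        -- non-negative.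
        (≤-by (D + (p * ((q - 1ℤ) * (q - 1ℤ)) + + 3 * p))
          (+-nonneg 0≤D (+-nonneg (*-nonneg 0≤p (square-nonneg (q - 1ℤ))) (*-nonneg {+ 3} 0≤+ 0≤p))) (lem D p q))
        where
        lem : ∀ D p q → p * (q + + 2) + q * D
          ≡ q * D - D + -1ℤ * p * (q - + 2) * (q - 1ℤ) + (D + (p * ((q - 1ℤ) * (q - 1ℤ)) + + 3 * p))
        lem = solve-∀

    -- If `Q (z ⊖ y)` is 0, then `pencilRadius` vanishes identically, Z = q, and the correlation is
    -- p (q (q - 3) + 2). It is rounded up to p q (q + 2), so that the final estimate can treat all
    -- cases alike.
    correlation-≤-zero-hyperbolic : σ ≡ 1ℤ → ∀ s t → proj₂ s ≡ 0# → proj₂ t ≡ 0# →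
      correlation s t ≤ p * (q * (q + + 2)) + q * D * 𝟙 (t ≟ˢ s)
    correlation-≤-zero-hyperbolic refl = correlation-≤ (_≡ 0#)
      (λ { y z _ _ refl refl → distinct y z })
      (λ { y r r′ refl refl r≢r′ → contradiction refl r≢r′ })
      (λ { y _ refl → self y })
      where
      distinct : ∀ y z → y ≢ z → correlation (y , 0#) (z , 0#) ≤ p * (q * (q + + 2))
      distinct y z y≢z = subst (_≤ p * (q * (q + + 2))) (sym (distinct-zero y z y≢z))
        -- The slack besides q (q - Z) is 5q - 2, split so that 1 ≤ q shows its sign.
        (≤-by (p * (q * (q - Z) + (+ 3 * q + + 2 * (q - 1ℤ))))
          (*-nonneg 0≤p (+-nonneg (*-nonneg {q} 0≤+ (i≤j⇒0≤j-i Z≤q))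
            (+-nonneg (*-nonneg {+ 3} {q} 0≤+ 0≤+) (*-nonneg {+ 2} 0≤+ (i≤j⇒0≤j-i 1≤q))))) (lem p q Z))
        where
        Z : ℤ
        Z = ∑[ l ← elements ] δ (pencilRadius 0# 0# (Q (z ⊖ y)) l)
        Z≤q : Z ≤ q
        Z≤q = subst (Z ≤_) (trans (∑-const elements 1ℤ) (*-identityʳ q)) (∑-mono elements λ l → 𝟙≤1 (_ ≟ᶠ 0#))
        lem : ∀ p q Z → p * (q * (q + + 2))
          ≡ 1ℤ * p * (q * (Z - + 3) + + 2) + p * (q * (q - Z) + (+ 3 * q + + 2 * (q - 1ℤ)))
        lem = solve-∀

      self : ∀ y → correlation (y , 0#) (y , 0#) ≤ p * (q * (q + + 2)) + q * D
      self y = subst (_≤ p * (q * (q + + 2)) + q * D) (sym (self-zero y))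
        (≤-by (D + p * (+ 3 * q + + 2 * (q - 1ℤ)))
          (+-nonneg 0≤D (*-nonneg 0≤p (+-nonneg (*-nonneg {+ 3} {q} 0≤+ 0≤+) (*-nonneg {+ 2} 0≤+ (i≤j⇒0≤j-i 1≤q)))))
          (lem D p q))
        where
        lem : ∀ D p q → p * (q * (q + + 2)) + q * D
          ≡ q * D - D + 1ℤ * p * (q - + 2) * (q - 1ℤ) + (D + p * (+ 3 * q + + 2 * (q - 1ℤ)))
        lem = solve-∀

    module _ (P : List (Vec Carrier (double n))) (S : List (Sphere F (double n))) where

      deviation : ℤ
      deviation = ∑[ x ← P ] ∑[ s ← S ] (q * χ s x - 1ℤ)

      deviation-incidences : deviation ≡ + (size ℕ.* incidences F Q P S) - + (length P ℕ.* length S)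
      deviation-incidences = begin
        ∑[ x ← P ] ∑[ s ← S ] (q * χ s x - 1ℤ)
          ≡⟨ ∑-cong P (λ x → trans (∑-+ S _ _) (cong₂ _+_ (∑-*ˡ S q _) (∑-const S -1ℤ))) ⟩
        ∑[ x ← P ] (q * (∑[ s ← S ] χ s x) + + length S * -1ℤ)
          ≡⟨ trans (∑-+ P _ _) (cong₂ _+_ (∑-*ˡ P q _) (∑-const P _)) ⟩
        q * (∑[ x ← P ] ∑[ s ← S ] χ s x) + + length P * (+ length S * -1ℤ)
          ≡⟨ cong (λ i → q * i + + length P * (+ length S * -1ℤ)) incidences-sum ⟨
        q * + incidences F Q P S + + length P * (+ length S * -1ℤ)
          ≡⟨ regroup q (+ incidences F Q P S) (+ length P) (+ length S) ⟩
        q * + incidences F Q P S - + length P * + length S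
          ≡⟨ cong₂ _-_ (pos-* size (incidences F Q P S)) (pos-* (length P) (length S)) ⟨
        + (size ℕ.* incidences F Q P S) - + (length P ℕ.* length S) ∎
        where
        open ≡-Reasoning
        incidences-sum : + incidences F Q P S ≡ ∑[ x ← P ] ∑[ s ← S ] χ s x
        incidences-sum = trans (+sum-map _ P) (∑-cong P λ x → +length-filter (onSphere? F Q x) S)
        regroup : ∀ q i a b → q * i + a * (b * -1ℤ) ≡ q * i - a * b
        regroup = solve-∀

      -- Cauchy-Schwarz is applied over `P`, which gives the factor |P|; only then are the squares
      -- summed over the whole space, where correlations are computable. Since `S` has no
      -- repetitions, `q * D` is paid once for each `s`.
      deviation-bound : Unique P → Unique S → ∀ {Radius : Carrier → Set} → All (Radius ∘ proj₂) S → ∀ K →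
        (∀ s t → Radius (proj₂ s) → Radius (proj₂ t) → correlation s t ≤ K + q * D * 𝟙 (t ≟ˢ s)) →
        deviation * deviation ≤ + length P * (+ length S * (+ length S * K + q * D))
      deviation-bound uP uS {Radius} radii K bound = begin
        deviation * deviation
          ≤⟨ cauchy-schwarz P dev ⟩
        + length P * (∑[ x ← P ] dev x * dev x)
          ≤⟨ *-monoˡ-≤-nonNeg (+ length P) second-moment ⟩
        + length P * (+ length S * (+ length S * K + q * D)) ∎
        where
        open ≤-Reasoning
        dev : Vec Carrier (double n) → ℤ
        dev x = ∑[ s ← S ] (q * χ s x - 1ℤ)

        row : ∀ s → ∑[ t ← S ] (K + q * D * 𝟙 (t ≟ˢ s)) ≤ + length S * K + q * D
        row s = begin
          ∑[ t ← S ] (K + q * D * 𝟙 (t ≟ˢ s))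
            ≡⟨ trans (∑-+ S _ _) (cong₂ _+_ (∑-const S K) (∑-*ˡ S (q * D) _)) ⟩
          + length S * K + q * D * (∑[ t ← S ] 𝟙 (t ≟ˢ s))
            ≤⟨ +-monoʳ-≤ (+ length S * K)
                 (*-monoˡ-≤-nonNeg (q * D) ⦃ nonNegative (*-nonneg {q} 0≤+ 0≤D) ⦄ (count-≤1 _≟ˢ_ s uS)) ⟩
          + length S * K + q * D * 1ℤ
            ≡⟨ cong (_+_ (+ length S * K)) (*-identityʳ (q * D)) ⟩
          + length S * K + q * D ∎

        second-moment : ∑[ x ← P ] dev x * dev x ≤ + length S * (+ length S * K + q * D)
        second-moment = begin
          ∑[ x ← P ] dev x * dev x
            ≤⟨ ∑-⊆ _≟ᵛ_ (vectors-unique (double n)) vectors-complete uP (λ x → square-nonneg (dev x)) ⟩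
          ∑[ x ← V ] dev x * dev x
            ≡⟨ ∑-cong V (λ x → ∑-product S S _ _) ⟩
          ∑[ x ← V ] ∑[ s ← S ] ∑[ t ← S ] (q * χ s x - 1ℤ) * (q * χ t x - 1ℤ)
            ≡⟨ trans (∑-swap V S _) (∑-cong S λ s → ∑-swap V S _) ⟩
          ∑[ s ← S ] ∑[ t ← S ] correlation s t
            ≤⟨ ∑-mono-All radii (λ ρ → ∑-mono-All radii (bound _ _ ρ)) ⟩
          ∑[ s ← S ] ∑[ t ← S ] (K + q * D * 𝟙 (t ≟ˢ s))
            ≤⟨ ∑-mono S row ⟩
          ∑[ s ← S ] (+ length S * K + q * D)
            ≡⟨ ∑-const S _ ⟩
          + length S * (+ length S * K + q * D) ∎

-- Absorbing the lower-order terms into the factor 1 + o(1).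

module Arithmetic where

  open import Data.Integer as ℤ using (ℤ; +_; ∣_∣)
  import Data.Integer.Properties as ℤ
  open import Data.Nat
  open import Data.Nat.Properties
  open import Data.Nat.Tactic.RingSolver using (solve-∀)

  private
    -- For c ≤ z one has 1 + 2/z ≤ 1 + 2/c ≤ (1 + 1/c)²; this is that chain with denominators
    -- cleared.
    coefficient-≤ : ∀ c {z} → c ≤ z → c * c * (z * (z + 2)) ≤ suc c * suc c * (z * z)
    coefficient-≤ c {z} c≤z = begin
      c * c * (z * (z + 2))                    ≡⟨ expand c z ⟩
      c * c * (z * z) + 2 * (c * z) * c        ≤⟨ +-monoʳ-≤ (c * c * (z * z)) (*-monoʳ-≤ (2 * (c * z)) c≤z) ⟩
      c * c * (z * z) + 2 * (c * z) * z        ≤⟨ m≤m+n _ (z * z) ⟩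
      c * c * (z * z) + 2 * (c * z) * z + z * z ≡⟨ collect c z ⟩
      suc c * suc c * (z * z)                  ∎
      where
      open ≤-Reasoning
      expand : ∀ c z → c * c * (z * (z + 2)) ≡ c * c * (z * z) + 2 * (c * z) * c
      expand = solve-∀
      collect : ∀ c z → c * c * (z * z) + 2 * (c * z) * z + z * z ≡ suc c * suc c * (z * z)
      collect = solve-∀

    ^2≡* : ∀ x → x ^ 2 ≡ x * x
    ^2≡* x = cong (x *_) (*-identityʳ x)

    ℕ-bound : ∀ k z w nP nS A B → suc k ≤ z →
      w * w ≤ nP * (nS * (nS * (B * (z * (z + 2))) + z * (z * A))) →
      suc k ^ 2 * w ^ 2 ≤ suc (suc k) ^ 2 * z ^ 2 * nP * (A * nS + B * nS ^ 2)
    ℕ-bound k z w nP nS A B c≤z hyp = begin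
      c ^ 2 * w ^ 2
        ≡⟨ cong₂ _*_ (^2≡* c) (^2≡* w) ⟩
      c * c * (w * w)
        ≤⟨ *-monoʳ-≤ (c * c) hyp ⟩
      c * c * (nP * (nS * (nS * (B * (z * (z + 2))) + z * (z * A))))
        ≡⟨ distribute c nP nS A B z ⟩
      nP * (nS * nS * B * (c * c * (z * (z + 2))) + nS * A * (c * c * (z * z)))
        ≤⟨ *-monoʳ-≤ nP (+-mono-≤
             (*-monoʳ-≤ (nS * nS * B) (coefficient-≤ c c≤z))
             (*-monoʳ-≤ (nS * A) (*-monoˡ-≤ (z * z) (*-mono-≤ (n≤1+n c) (n≤1+n c))))) ⟩
      nP * (nS * nS * B * (suc c * suc c * (z * z)) + nS * A * (suc c * suc c * (z * z)))
        ≡⟨ collect (suc c) nP nS A B z ⟩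
      suc c * suc c * (z * z) * nP * (A * nS + B * (nS * nS))
        ≡⟨ cong₂ _*_ (cong₂ (λ a b → a * b * nP) (^2≡* (suc c)) (^2≡* z)) (cong (λ a → A * nS + B * a) (^2≡* nS)) ⟨
      suc c ^ 2 * z ^ 2 * nP * (A * nS + B * nS ^ 2) ∎
      where
      open ≤-Reasoning
      c : ℕ
      c = suc k
      distribute : ∀ c nP nS A B z → c * c * (nP * (nS * (nS * (B * (z * (z + 2))) + z * (z * A))))
        ≡ nP * (nS * nS * B * (c * c * (z * (z + 2))) + nS * A * (c * c * (z * z)))
      distribute = solve-∀
      collect : ∀ e nP nS A B z → nP * (nS * nS * B * (e * e * (z * z)) + nS * A * (e * e * (z * z)))
        ≡ e * e * (z * z) * nP * (A * nS + B * (nS * nS))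
      collect = solve-∀

  square≡+∣∣*∣∣ : ∀ i → i ℤ.* i ≡ + (∣ i ∣ * ∣ i ∣)
  square≡+∣∣*∣∣ (+ n)      = sym (ℤ.pos-* n n)
  square≡+∣∣*∣∣ ℤ.-[1+ n ] = refl

  pos-^ : ∀ z n → + (z ^ n) ≡ (+ z) ℤ.^ n
  pos-^ z zero    = refl
  pos-^ z (suc n) = trans (ℤ.pos-* z (z ^ n)) (cong (+ z ℤ.*_) (pos-^ z n))

  Bound-from-ℤ : ∀ k q I nP nS a b {W K E : ℤ} → suc k ≤ q →
    W ≡ + (q * I) ℤ.- + (nP * nS) →
    W ℤ.* W ℤ.≤ + nP ℤ.* (+ nS ℤ.* (+ nS ℤ.* K ℤ.+ E)) →
    K ≡ + (q ^ b * (q * (q + 2))) → E ≡ + (q * (q * q ^ a)) →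
    Bound k q I nP nS a b
  Bound-from-ℤ k q I nP nS a b {W} c≤q refl hyp refl refl =
    ℕ-bound k q ∣ W ∣ nP nS (q ^ a) (q ^ b) c≤q
      (ℤ.drop‿+≤+ (subst₂ ℤ._≤_ (square≡+∣∣*∣∣ W) (sym push) hyp))
    where
    K E : ℕ
    K = q ^ b * (q * (q + 2))
    E = q * (q * q ^ a)
    push : + (nP * (nS * (nS * K + E))) ≡ + nP ℤ.* (+ nS ℤ.* (+ nS ℤ.* + K ℤ.+ + E))
    push = trans (ℤ.pos-* nP _) (cong (+ nP ℤ.*_) (trans (ℤ.pos-* nS _) (cong (+ nS ℤ.*_)
      (trans (ℤ.pos-+ (nS * K) E) (cong (ℤ._+ + E) (ℤ.pos-* nS K))))))

-- Assembling the three incidence bounds.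

module Incidences (F : FiniteField) where

  open FiniteField F using (Carrier; size; 0#; NonSquare; Q₁; Q₂)
  open FieldCounting F using (q; 1+1≢0)
  open QuadraticForms F
  open Conic F
  open Correlation F
  open Arithmetic
  open import Data.Integer as ℤ using (ℤ; +_; 1ℤ; -1ℤ)
  import Data.Integer.Properties as ℤ
  open import Data.Nat
  open import Data.Nat.Properties
  open import Data.Integer.Tactic.RingSolver using (solve-∀)

  2*≡double : ∀ n → 2 * n ≡ double n
  2*≡double zero    = refl
  2*≡double (suc n) = cong suc (trans (+-suc n (n + 0)) (cong suc (2*≡double n)))

  private
    -- The diagonal term is q² q^(d-1). The exponent d - 1 has the shape `m + suc m` because
    -- `2 * suc m` unfolds to its successor, up to `m + 0`.
    q*D : ∀ m → q ℤ.* q ℤ.^ double (suc m) ≡ + (size * (size * size ^ (m + suc m)))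
    q*D m = begin
      q ℤ.* q ℤ.^ double (suc m)                 ≡⟨ cong (q ℤ.*_) (pos-^ size (double (suc m))) ⟨
      q ℤ.* + (size ^ double (suc m))            ≡⟨ ℤ.pos-* size _ ⟨
      + (size * size ^ double (suc m))           ≡⟨ cong (λ n → + (size * size ^ n)) (2*≡double (suc m)) ⟨
      + (size * size ^ (2 * suc m))              ≡⟨ cong (λ n → + (size * size ^ (suc m + suc n))) (+-identityʳ m) ⟩
      + (size * (size * size ^ (m + suc m)))     ∎
      where open ≡-Reasoning

    coefficient : ∀ b → q ℤ.^ b ℤ.* (q ℤ.* (q ℤ.+ + 2)) ≡ + (size ^ b * (size * (size + 2)))
    coefficient b = sym (begin
      + (size ^ b * (size * (size + 2)))            ≡⟨ ℤ.pos-* (size ^ b) _ ⟩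
      + (size ^ b) ℤ.* + (size * (size + 2))        ≡⟨ cong₂ ℤ._*_ (pos-^ size b)
                                                        (trans (ℤ.pos-* size _) (cong (q ℤ.*_) (ℤ.pos-+ size 2))) ⟩
      q ℤ.^ b ℤ.* (q ℤ.* (q ℤ.+ + 2))               ∎)
      where open ≡-Reasoning

    -- One of the n = m + 1 factors q moves into the coefficient, which leaves the exponent d/2 - 1
    -- of cases (a) and (b).
    coefficient-suc : ∀ m → q ℤ.^ suc m ℤ.* (q ℤ.+ + 2) ≡ + (size ^ m * (size * (size + 2)))
    coefficient-suc m = trans (swap q (q ℤ.^ m)) (coefficient m)
      where
      swap : ∀ q p → q ℤ.* p ℤ.* (q ℤ.+ + 2) ≡ p ℤ.* (q ℤ.* (q ℤ.+ + 2))
      swap = solve-∀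

  module _ (m k : ℕ) (c≤q : suc k ≤ size) {P : List (Vec Carrier (double (suc m)))} (uP : Unique P) where

    module _ {σ : ℤ} {Q : Vec Carrier (double (suc m)) → Carrier} (form : IsForm σ (suc m) Q)
             {S : List (Sphere F (double (suc m)))} (uS : Unique S) where

      bound-nonzero : σ ≡ 1ℤ ⊎ σ ≡ -1ℤ → All (λ s → proj₂ s ≢ 0#) S →
        Bound k size (incidences F Q P S) (length P) (length S) (m + suc m) m
      bound-nonzero σ≡±1 radii = Bound-from-ℤ k size (incidences F Q P S) (length P) (length S) (m + suc m) m c≤q
        (deviation-incidences form P S)
        (deviation-bound form P S uP uS radii _ (correlation-≤-nonzero form σ≡±1))
        (coefficient-suc m) (q*D m)

      bound-zero-elliptic : σ ≡ -1ℤ → All (λ s → proj₂ s ≡ 0#) S →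
        Bound k size (incidences F Q P S) (length P) (length S) (m + suc m) m
      bound-zero-elliptic σ≡-1 radii = Bound-from-ℤ k size (incidences F Q P S) (length P) (length S) (m + suc m) m c≤q
        (deviation-incidences form P S)
        (deviation-bound form P S uP uS radii _ (correlation-≤-zero-elliptic form σ≡-1))
        (coefficient-suc m) (q*D m)

      bound-zero-hyperbolic : σ ≡ 1ℤ → All (λ s → proj₂ s ≡ 0#) S →
        Bound k size (incidences F Q P S) (length P) (length S) (m + suc m) (suc m)
      bound-zero-hyperbolic σ≡1 radii =
        Bound-from-ℤ k size (incidences F Q P S) (length P) (length S) (m + suc m) (suc m) c≤q
          (deviation-incidences form P S)
          (deviation-bound form P S uP uS radii _ (correlation-≤-zero-hyperbolic form σ≡1))
          (coefficient (suc m)) (q*D m)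

  -- The dimension is a variable tied to `double (suc m)` by an equation, so that matching `refl`
  -- transports the whole statement from `2 * suc m` at once.
  bounds : ∀ m k {d} → d ≡ double (suc m) → suc k ≤ size → size % 2 ≡ 1 →
    (ε : Carrier) → NonSquare ε → (P : List (Vec Carrier d)) → Unique P →
    ((i : Idx) → (S : List (Sphere F d)) → Unique S → All (λ s → proj₂ s ≢ 0#) S →
      Bound k size (incidences F (Qform F i ε) P S) (length P) (length S) (m + suc m) m)
    × ((S : List (Sphere F d)) → Unique S → All (λ s → proj₂ s ≡ 0#) S →
      Bound k size (incidences F (Qform F two ε) P S) (length P) (length S) (m + suc m) m)
    × ((S : List (Sphere F d)) → Unique S → All (λ s → proj₂ s ≡ 0#) S →
      Bound k size (incidences F (Qform F one ε) P S) (length P) (length S) (m + suc m) (suc m))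
  bounds m k refl c≤q odd ε ε-nonSquare P uP =
    (λ { one S uS → bound-nonzero m k c≤q uP hyperbolic uS (inj₁ refl)
       ; two S uS → bound-nonzero m k c≤q uP elliptic uS (inj₂ refl) }) ,
    (λ S uS → bound-zero-elliptic m k c≤q uP elliptic uS refl) ,
    (λ S uS → bound-zero-hyperbolic m k c≤q uP hyperbolic uS refl)
    where
    hyperbolic : IsForm 1ℤ (suc m) Q₁
    hyperbolic = Q₁-isForm (suc m)
    elliptic : IsForm -1ℤ (suc m) (Q₂ ε)
    elliptic = Q₂-isForm ε-nonSquare (1+1≢0 odd) m

open import Data.Nat using (ℕ; suc; _≤_; _*_; _+_; _%_)

theorem1p7 : (m k : ℕ) → ∃[ q₀ ] ((F : FiniteField) → q₀ ≤ FiniteField.size F → FiniteField.size F % 2 ≡ 1 →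
    (ε : FiniteField.Carrier F) → FiniteField.NonSquare F ε →
    (P : List (Vec (FiniteField.Carrier F) (2 * suc m))) → Unique P →
    ((i : Idx) → (S : List (Sphere F (2 * suc m))) → Unique S →
    All (λ s → proj₂ s ≢ FiniteField.0# F) S →
    Bound k (FiniteField.size F) (incidences F (Qform F i ε) P S) (length P) (length S) (m + suc m) m)
    × ((S : List (Sphere F (2 * suc m))) → Unique S →
    All (λ s → proj₂ s ≡ FiniteField.0# F) S →
    Bound k (FiniteField.size F) (incidences F (Qform F two ε) P S) (length P) (length S) (m + suc m) m)
    × ((S : List (Sphere F (2 * suc m))) → Unique S →
    All (λ s → proj₂ s ≡ FiniteField.0# F) S →
    Bound k (FiniteField.size F) (incidences F (Qform F one ε) P S) (length P) (length S) (m + suc m) (suc m)))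
-- The threshold k + 1 is the hypothesis of `coefficient-≤` with c = k + 1 and z = q; it is the same
-- for every dimension.
theorem1p7 m k = suc k , λ F → Incidences.bounds F m k (Incidences.2*≡double F (suc m))
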